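{- Let $r\ge 1$, let $\lambda=(\lambda_1\ge\lambda_2\ge\cdots\ge\lambda_r\ge 0)$ be a partition with $r$ parts (some possibly zero), let $N\ge\lambda_1+r-1$, let $\mathbf{z}=(z_1,\dots,z_r)\in(\mathbb{C}^\times)^r$, and let $w\in S_r$. Then the partition function of the colored five-vertex system $\mathfrak{S}_{\mathbf{z},\lambda,w}$ satisfies $$Z(\mathfrak{S}_{\mathbf{z},\lambda,w})=\mathbf{z}^{\rho}\,\partial^\circ_w\,\mathbf{z}^{\lambda}.$$
   Context: Colored five-vertex system $\mathfrak{S}_{\mathbf{z},\lambda,w}$: take a grid with $r$ horizontal lines (rows, labeled $1,\dots,r$ from top to bottom) and $N+1$ vertical lines (columns, labeled $N,N-1,\dots,0$ from left to right); vertices are the intersections, and each vertex has a left, top, right and bottom adjacent edge; boundary edges are those attached to only one vertex. Fix a totally ordered set of colors $c_1>c_2>\cdots>c_r$. A colored spin is either $+$ or a color. Boundary conditions: the top boundary edge in column $\lambda_k+r-k$ carries color $c_k$ ($k=1,\dots,r$), all other top boundary edges carry $+$; all left and bottom boundary edges carry $+$; the right boundary edge of row $k$ carries color $c_{w^{ -1}(k)}$. A state is an assignment of colored spins to all interior edges. The Boltzmann weight of a vertex in row $k$ whose (left, top, right, bottom) edges carry $(\ell,t,\rho',b)$ is: $1$ for $(+,+,+,+)$; $z_k$ for $(c,d,\max(c,d),\min(c,d))$ with $c,d$ colors (possibly equal); $z_k$ for $(c,+,c,+)$; $z_k$ for $(c,+,+,c)$; $1$ for $(+,c,c,+)$ (here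 $c$ any color); and $0$ for every other configuration (in particular $(+,c,+,c)$ has weight $0$). The weight $\beta(\mathfrak{s})$ of a state is the product of the weights of its vertices, and $Z(\mathfrak{S}_{\mathbf{z},\lambda,w})=\sum_{\mathfrak{s}}\beta(\mathfrak{s})$ over all states. Notation: $\mathbf{z}^\mu=\prod_i z_i^{\mu_i}$ for $\mu\in\mathbb{Z}^r$, $\rho=(r-1,r-2,\dots,1,0)$. $S_r$ acts on functions of $\mathbf{z}$ by permuting variables; $s_i$ is the transposition $(i,i+1)$. For $1\le i\le r-1$ and a Laurent polynomial $f$, $\partial^\circ_i f(\mathbf{z})=\dfrac{f(\mathbf{z})-f(s_i\mathbf{z})}{z_i/z_{i+1}-1}$. These satisfy the braid relations, so for $w=s_{i_1}\cdots s_{i_k}$ reduced, $\partial^\circ_w=\partial^\circ_{i_1}\cdots\partial^\circ_{i_k}$ is well defined, with $\partial^\circ_1=1$. -}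

module Defs where

open import Data.Nat as ℕ using (ℕ; zero; suc; _∸_)
open import Data.Integer as ℤ using (ℤ; +_; -_; 1ℤ; 0ℤ)
open import Data.Fin as F using (Fin; zero; suc; toℕ; inject₁; fromℕ)
open import Data.Fin.Properties using () renaming (_≟_ to _≟F_)
open import Data.Fin.Permutation using (Permutation′; _⟨$⟩ʳ_; _⟨$⟩ˡ_)
open import Data.Maybe using (Maybe; just; nothing)
import Data.Maybe.Properties as MP
open import Data.Bool using (Bool; true; false; _∧_; if_then_else_)
open import Data.List as L using (List; []; _∷_; _++_; map; concatMap; foldr; length; allFin)
open import Data.Vec as V using (Vec; lookup; tabulate; zipWith)
import Data.Vec.Properties as VP
open import Data.Product using (Σ; _×_; _,_)
open import Relation.Nullary using (does)
open import Relation.Binary.PropositionalEquality using (_≡_)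

-- Laurent polynomials in r variables z_1..z_r with integer coefficients,
-- represented as finite lists of terms (coefficient, exponent vector),
-- compared by their coefficient functions.

LPoly : ℕ → Set
LPoly r = List (ℤ × Vec ℤ r)

coeff : ∀ {r} → LPoly r → Vec ℤ r → ℤ
coeff [] μ = 0ℤ
coeff ((a , ν) ∷ p) μ =
  if does (VP.≡-dec ℤ._≟_ ν μ) then a ℤ.+ coeff p μ else coeff p μ

infix 4 _≈_
_≈_ : ∀ {r} → LPoly r → LPoly r → Set
p ≈ q = ∀ μ → coeff p μ ≡ coeff q μ

0P : ∀ {r} → LPoly r
0P = []

_+P_ : ∀ {r} → LPoly r → LPoly r → LPoly r
p +P q = p ++ q

-P_ : ∀ {r} → LPoly r → LPoly r
-P p = map (λ { (a , μ) → (ℤ.- a , μ) }) p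

_-P_ : ∀ {r} → LPoly r → LPoly r → LPoly r
p -P q = p +P (-P q)

_*P_ : ∀ {r} → LPoly r → LPoly r → LPoly r
p *P q = concatMap (λ { (a , μ) → map (λ { (b , ν) → (a ℤ.* b , zipWith ℤ._+_ μ ν) }) q }) p

mono : ∀ {r} → Vec ℤ r → LPoly r
mono μ = (1ℤ , μ) ∷ []

1P : ∀ {r} → LPoly r
1P = mono (V.replicate _ 0ℤ)

var : ∀ {r} → Fin r → LPoly r
var k = mono (tabulate (λ j → if does (j ≟F k) then 1ℤ else 0ℤ))

invVar : ∀ {r} → Fin r → LPoly r
invVar k = mono (tabulate (λ j → if does (j ≟F k) then ℤ.- 1ℤ else 0ℤ))

prodP : ∀ {r} → List (LPoly r) → LPoly r
prodP = foldr _*P_ 1P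

sumP : ∀ {r} → List (LPoly r) → LPoly r
sumP = foldr _+P_ 0P

swapFun : ∀ {n} → Fin n → Fin (suc n) → Fin (suc n)
swapFun i x =
  if does (x ≟F inject₁ i) then suc i
  else (if does (x ≟F suc i) then inject₁ i else x)

wordFun : ∀ {n} → List (Fin n) → Fin (suc n) → Fin (suc n)
wordFun [] x = x
wordFun (i ∷ is) x = swapFun i (wordFun is x)

IsWordFor : ∀ {n} → Permutation′ (suc n) → List (Fin n) → Set
IsWordFor w is = ∀ x → w ⟨$⟩ʳ x ≡ wordFun is x

IsReducedWordFor : ∀ {n} → Permutation′ (suc n) → List (Fin n) → Set
IsReducedWordFor w is =
  IsWordFor w is × (∀ js → IsWordFor w js → length is ℕ.≤ length js)

actS : ∀ {n} → Fin n → LPoly (suc n) → LPoly (suc n)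
actS i p = map (λ { (a , μ) → (a , tabulate (λ x → lookup μ (swapFun i x))) }) p

-- g = ∂°_i f, i.e. (z_i/z_{i+1} - 1) · g = f - s_i f
-- (division in the integral domain of Laurent polynomials)
IsDemazure₁ : ∀ {n} → Fin n → LPoly (suc n) → LPoly (suc n) → Set
IsDemazure₁ i f g =
  ((var (inject₁ i) *P invVar (suc i)) -P 1P) *P g ≈ f -P actS i f

IsDemazure : ∀ {n} → List (Fin n) → LPoly (suc n) → LPoly (suc n) → Set
IsDemazure [] f g = g ≈ f
IsDemazure (i ∷ is) f g = Σ (LPoly _) (λ h → IsDemazure is f h × IsDemazure₁ i h g)

-- Colored five-vertex model.
-- Colors c_1 > ⋯ > c_r are encoded as Fin r (c_k ↦ index k-1), so
-- color c is larger than d iff its index is smaller.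
-- A spin is nothing (= +) or just c.

Spin : ℕ → Set
Spin r = Maybe (Fin r)

_≟S_ : ∀ {r} (s t : Spin r) → _
_≟S_ = MP.≡-dec _≟F_

cmax cmin : ∀ {r} → Fin r → Fin r → Fin r
-- cmax c d = larger color = smaller index; cmin = smaller color
cmax c d = if does (toℕ c ℕ.≤? toℕ d) then c else d
cmin c d = if does (toℕ c ℕ.≤? toℕ d) then d else c

data VW : Set where
  w0 w1 wz : VW

-- weight type of a vertex with (left, top, right, bottom) spins
vw : ∀ {r} → Spin r → Spin r → Spin r → Spin r → VW
vw nothing nothing nothing nothing = w1
vw (just c) (just d) ρ b =
  if does (ρ ≟S just (cmax c d)) ∧ does (b ≟S just (cmin c d)) then wz else w0
vw (just c) nothing (just c') nothing = if does (c ≟F c') then wz else w0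
vw (just c) nothing nothing (just c') = if does (c ≟F c') then wz else w0
vw nothing (just c) (just c') nothing = if does (c ≟F c') then w1 else w0
vw _ _ _ _ = w0

vwPoly : ∀ {r} → Fin r → VW → LPoly r
vwPoly k w0 = 0P
vwPoly k w1 = 1P
vwPoly k wz = var k

-- An edge assignment for the grid with r rows and N+1 columns.
-- Columns are indexed by j : Fin (N+1) with toℕ j = its label (N..0, left
-- to right).  Horizontal edges of row k: hor k p, p : Fin (N+2); the
-- vertex (k, j) has left edge hor k (suc j) and right edge hor k (inject₁ j);
-- so hor k zero is the right boundary edge and hor k (fromℕ (suc N)) the
-- left boundary edge.  Vertical edges: ver q j, q : Fin (r+1); vertex (k, j)
-- has top edge ver (inject₁ k) j and bottom edge ver (suc k) j; ver zero j is
-- the top boundary and ver (fromℕ r) j the bottom boundary.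
record Assignment (r N : ℕ) : Set where
  constructor mkA
  field
    hor : Fin r → Fin (suc (suc N)) → Spin r
    ver : Fin (suc r) → Fin (suc N) → Spin r
open Assignment public

allFuns : ∀ {A : Set} (m : ℕ) → List A → List (Fin m → A)
allFuns zero xs = (λ ()) ∷ []
allFuns (suc m) xs =
  concatMap (λ x → map (λ f → λ { zero → x ; (suc i) → f i }) (allFuns m xs)) xs

allSpins : (r : ℕ) → List (Spin r)
allSpins r = nothing ∷ map just (allFin r)

allAssignments : (r N : ℕ) → List (Assignment r N)
allAssignments r N =
  concatMap (λ h → map (λ v → mkA h v)
                       (allFuns (suc r) (allFuns (suc N) (allSpins r))))
            (allFuns r (allFuns (suc (suc N)) (allSpins r)))

allB : ∀ {A : Set} → (A → Bool) → List A → Bool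
allB p = foldr (λ x b → p x ∧ b) true

module System (n : ℕ) (λ′ : Fin (suc n) → ℕ) (N : ℕ)
              (w : Permutation′ (suc n)) where
  r = suc n

  -- column of the top boundary edge carrying c_k (0-based k): λ_k + r - k
  colPos : Fin r → ℕ
  colPos k = λ′ k ℕ.+ (n ∸ toℕ k)

  topSpin : Fin (suc N) → Spin r
  topSpin j = foldr (λ k acc → if does (toℕ j ℕ.≟ colPos k) then just k else acc)
                    nothing (allFin r)

  rightSpin : Fin r → Spin r
  rightSpin k = just (w ⟨$⟩ˡ k)

  boundaryOK : Assignment r N → Bool
  boundaryOK a =
       allB (λ j → does (ver a zero j ≟S topSpin j)) (allFin (suc N))
     ∧ allB (λ j → does (ver a (fromℕ r) j ≟S nothing)) (allFin (suc N))
     ∧ allB (λ k → does (hor a k (fromℕ (suc N)) ≟S nothing)) (allFin r)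
     ∧ allB (λ k → does (hor a k zero ≟S rightSpin k)) (allFin r)

  weight : Assignment r N → LPoly r
  weight a = prodP (concatMap (λ k → map (λ j →
      vwPoly k (vw (hor a k (suc j)) (ver a (inject₁ k) j)
                   (hor a k (inject₁ j)) (ver a (suc k) j)))
      (allFin (suc N))) (allFin r))

  states : List (Assignment r N)
  states = L.filterᵇ boundaryOK (allAssignments r N)

  Z : LPoly r
  Z = sumP (map weight states)

Z : (n : ℕ) → (Fin (suc n) → ℕ) → ℕ → Permutation′ (suc n) → LPoly (suc n)
Z n λ′ N w = System.Z n λ′ N w

zPow : ∀ {n} → (Fin (suc n) → ℕ) → LPoly (suc n)
zPow λ′ = mono (tabulate (λ k → + (λ′ k)))

zρ : ∀ {n} → LPoly (suc n)
zρ {n} = mono (tabulate (λ k → + (n ∸ toℕ k)))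

IsPartition : ∀ {n} → (Fin (suc n) → ℕ) → Set
IsPartition λ′ = ∀ i j → i F.≤ j → λ′ j ℕ.≤ λ′ i

{-# OPTIONS --safe #-}
-- A row of the lattice is a linear functional on functions of its right and bottom
-- spins.  For two adjacent rows with parameters x and y there is an R-matrix acting on
-- pairs of horizontal spins and satisfying the Yang–Baxter equation, so it can be pushed
-- through the columns from the right boundary to the left one, where both spins are +.
-- Comparing the two ends for the exits (c , e), c > e, gives
--   y Z(c,e) + (y - x) Z(e,c) = x s_i Z(c,e),
-- which after division by z^ρ is the recursion defining ∂°_i.  The exchange property
-- shows that along a reduced word c > e holds at every step, and for w = 1 every color
-- leaves through its own row without turning down, so there is a single state, of weight z^{λ+ρ}.
module Submission where

open import Defs
open import Algebra.Bundles using (CommutativeRing)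
import Algebra.Properties.AbelianGroup as AbelianGroup
import Algebra.Solver.Ring.NaturalCoefficients.Default as Solver
open import Data.Bool using (Bool; true; false; if_then_else_; _∧_)
open import Data.Empty using (⊥-elim)
open import Data.Fin as Fin using (Fin; zero; suc; inject₁; toℕ; fromℕ)
open import Data.Fin.Permutation using (Permutation′; _⟨$⟩ˡ_; inverseˡ; inverseʳ)
import Data.Fin.Properties as Fin
open import Data.Integer as ℤ using (ℤ; 0ℤ; 1ℤ)
open import Data.Integer.Tactic.RingSolver using (solve-∀)
import Data.Integer.Properties as ℤ
open import Data.List as List using (List; []; _∷_; _++_; concatMap; allFin; foldr; length)
import Data.List.Properties as List
open import Data.Maybe using (just; nothing)
import Data.Maybe.Properties as Maybe
open import Data.Nat as ℕ using (ℕ; zero; suc; z≤n; s≤s; _∸_; _⊓_; _⊔_; _≥_)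
import Data.Nat.Properties as ℕ
open import Data.Product using (Σ; _×_; _,_; ∃-syntax)
open import Data.Sum using (_⊎_; inj₁; inj₂)
open import Data.Vec as Vec using (Vec; []; _∷_; lookup; replicate; tabulate; zipWith)
import Data.Vec.Functional as Fun
import Data.Vec.Properties as Vec
open import Function using (_∘_; id; mk⇔)
open import Level using (0ℓ)
open import Relation.Binary.Definitions using (tri<; tri≈; tri>)
open import Relation.Binary.PropositionalEquality as ≡
  using (_≡_; _≢_; refl; sym; trans; cong; cong₂; subst; subst₂)
open import Relation.Nullary using (Dec; yes; no; does)
open import Relation.Nullary.Decidable using (dec-true; dec-false; does-⇔)

-- `∂°_i` is a division, and `IsDemazure` asks for a polynomial at every letter. Nothing is divided:
-- for each suffix of the word the polynomial supplied is the inverse of z^ρ times the partition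
-- function with the exits of that suffix. The lattice provides the quotients, and only the
-- multiplied-out relation is checked. The factor z^ρ enters because s_i multiplies its inverse by
-- z_i/z_{i+1}, the very ratio in the definition of `∂°_i`. One term of the R-matrix replaces a pair
-- of colors by the sorted pair. Tested at exits (c , e) with c > e it sees both orders; tested at
-- (e , c) the sorted term vanishes and Z(c , e) does not appear. So the recursion runs in one
-- direction only, and each letter of a reduced word has to be shown to be an ascent. A row is a
-- functional of its outputs rather than a matrix, so that linearity is the only tool needed to move
-- rows past vertices. The sum over all assignments, whose members are functions and agree only
-- pointwise, is converted to this form once.

private
  variable
    n r : ℕ

-- Laurent polynomials form a commutative ring

module _ where
  open import Data.Integer using (_+_; _*_; -_; _-_)

  Exponent : ℕ → Set
  Exponent = Vec ℤ

  infixl 6 _⊕_ _⊖_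
  _⊕_ _⊖_ : Exponent r → Exponent r → Exponent r
  _⊕_ = zipWith _+_
  _⊖_ = zipWith _-_

  _≟E_ : (μ ν : Exponent r) → Dec (μ ≡ ν)
  _≟E_ = Vec.≡-dec ℤ._≟_

  ⊖-⊕ : (μ ν : Exponent r) → (μ ⊕ ν) ⊖ μ ≡ ν
  ⊖-⊕ [] [] = refl
  ⊖-⊕ (m ∷ μ) (n ∷ ν) = cong₂ _∷_ (eq m n) (⊖-⊕ μ ν)
    where
    eq : ∀ m n → (m + n) - m ≡ n
    eq = solve-∀

  ⊕-⊖ : (μ κ : Exponent r) → μ ⊕ (κ ⊖ μ) ≡ κ
  ⊕-⊖ [] [] = refl
  ⊕-⊖ (m ∷ μ) (k ∷ κ) = cong₂ _∷_ (eq m k) (⊕-⊖ μ κ)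
    where
    eq : ∀ m k → m + (k - m) ≡ k
    eq = solve-∀

  ⊖-⊕-assoc : (κ μ ν : Exponent r) → κ ⊖ (μ ⊕ ν) ≡ (κ ⊖ μ) ⊖ ν
  ⊖-⊕-assoc [] [] [] = refl
  ⊖-⊕-assoc (k ∷ κ) (m ∷ μ) (n ∷ ν) = cong₂ _∷_ (eq k m n) (⊖-⊕-assoc κ μ ν)
    where
    eq : ∀ k m n → k - (m + n) ≡ (k - m) - n
    eq = solve-∀

  ⊖-0 : (κ : Exponent r) → κ ⊖ replicate _ 0ℤ ≡ κ
  ⊖-0 [] = refl
  ⊖-0 (k ∷ κ) = cong₂ _∷_ (ℤ.+-identityʳ k) (⊖-0 κ)

  ⊖-swap : (κ μ ν : Exponent r) → does (μ ≟E (κ ⊖ ν)) ≡ does (ν ≟E (κ ⊖ μ))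
  ⊖-swap κ μ ν = does-⇔ (mk⇔ (flip-eq μ ν) (flip-eq ν μ)) (μ ≟E (κ ⊖ ν)) (ν ≟E (κ ⊖ μ))
    where
    eq : ∀ k n → k - (k - n) ≡ n
    eq = solve-∀
    double : ∀ {r} (κ ν : Exponent r) → κ ⊖ (κ ⊖ ν) ≡ ν
    double [] [] = refl
    double (k ∷ κ) (n ∷ ν) = cong₂ _∷_ (eq k n) (double κ ν)
    flip-eq : ∀ μ ν → μ ≡ κ ⊖ ν → ν ≡ κ ⊖ μ
    flip-eq _ ν refl = sym (double κ ν)

  ⊕-≟ : (μ ν κ : Exponent r) → does ((μ ⊕ ν) ≟E κ) ≡ does (ν ≟E (κ ⊖ μ))
  ⊕-≟ μ ν κ = does-⇔
    (mk⇔ (λ e → trans (sym (⊖-⊕ μ ν)) (cong (_⊖ μ) e)) (λ e → trans (cong (μ ⊕_) e) (⊕-⊖ μ κ)))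
    ((μ ⊕ ν) ≟E κ) (ν ≟E (κ ⊖ μ))

  coeff₁ : ℤ → Exponent r → Exponent r → ℤ
  coeff₁ a ν μ = if does (ν ≟E μ) then a else 0ℤ

  coeff-∷ : ∀ a ν (p : LPoly r) μ → coeff ((a , ν) ∷ p) μ ≡ coeff₁ a ν μ + coeff p μ
  coeff-∷ a ν p μ with does (ν ≟E μ)
  ... | true  = refl
  ... | false = sym (ℤ.+-identityˡ _)

  *-coeff₁ : ∀ a b (ν μ : Exponent r) → coeff₁ (a * b) ν μ ≡ a * coeff₁ b ν μ
  *-coeff₁ a b ν μ with does (ν ≟E μ)
  ... | true  = refl
  ... | false = sym (ℤ.*-zeroʳ a)

  coeff₁-cross : ∀ a b (μ ν κ : Exponent r) →
    a * coeff₁ b ν (κ ⊖ μ) ≡ b * coeff₁ a μ (κ ⊖ ν)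
  coeff₁-cross a b μ ν κ rewrite ⊖-swap κ μ ν with does (ν ≟E (κ ⊖ μ))
  ... | true  = ℤ.*-comm a b
  ... | false = trans (ℤ.*-zeroʳ a) (sym (ℤ.*-zeroʳ b))

  coeff-++ : ∀ (p q : LPoly r) μ → coeff (p ++ q) μ ≡ coeff p μ + coeff q μ
  coeff-++ [] q μ = sym (ℤ.+-identityˡ _)
  coeff-++ ((a , ν) ∷ p) q μ = begin
    coeff ((a , ν) ∷ (p ++ q)) μ                    ≡⟨ coeff-∷ a ν (p ++ q) μ ⟩
    coeff₁ a ν μ + coeff (p ++ q) μ               ≡⟨ cong (coeff₁ a ν μ +_) (coeff-++ p q μ) ⟩
    coeff₁ a ν μ + (coeff p μ + coeff q μ)      ≡⟨ ℤ.+-assoc (coeff₁ a ν μ) (coeff p μ) (coeff q μ) ⟨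
    coeff₁ a ν μ + coeff p μ + coeff q μ        ≡⟨ cong (λ u → u + _) (coeff-∷ a ν p μ) ⟨
    coeff ((a , ν) ∷ p) μ + coeff q μ             ∎
    where open ≡.≡-Reasoning

  -- The term maps of Defs are anonymous, so F is characterised by its values.
  coeff-shift : ∀ a μ (F : ℤ × Exponent r → ℤ × Exponent r) →
    (∀ b ν → F (b , ν) ≡ (a * b , μ ⊕ ν)) →
    ∀ q p κ → coeff (List.map F q ++ p) κ ≡ a * coeff q (κ ⊖ μ) + coeff p κ
  coeff-shift a μ F F≡ [] p κ = sym (trans (cong (_+ coeff p κ) (ℤ.*-zeroʳ a)) (ℤ.+-identityˡ _))
  coeff-shift a μ F F≡ ((b , ν) ∷ q) p κ = begin
    coeff (F (b , ν) ∷ (List.map F q ++ p)) κ                   ≡⟨ cong (λ t → coeff (t ∷ (List.map F q ++ p)) κ) (F≡ b ν) ⟩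
    coeff ((a * b , μ ⊕ ν) ∷ (List.map F q ++ p)) κ             ≡⟨ coeff-∷ (a * b) (μ ⊕ ν) (List.map F q ++ p) κ ⟩
    coeff₁ (a * b) (μ ⊕ ν) κ + coeff (List.map F q ++ p) κ
      ≡⟨ cong₂ _+_ (cong (if_then a * b else 0ℤ) (⊕-≟ μ ν κ)) (coeff-shift a μ F F≡ q p κ) ⟩
    coeff₁ (a * b) ν κ′ + (a * coeff q κ′ + coeff p κ)     ≡⟨ cong (_+ (a * coeff q κ′ + coeff p κ)) (*-coeff₁ a b ν κ′) ⟩
    a * coeff₁ b ν κ′ + (a * coeff q κ′ + coeff p κ)       ≡⟨ factor a (coeff₁ b ν κ′) (coeff q κ′) (coeff p κ) ⟩
    a * (coeff₁ b ν κ′ + coeff q κ′) + coeff p κ           ≡⟨ cong (λ u → a * u + coeff p κ) (coeff-∷ b ν q κ′) ⟨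
    a * coeff ((b , ν) ∷ q) κ′ + coeff p κ                 ∎
    where
    open ≡.≡-Reasoning
    κ′ = κ ⊖ μ
    factor : ∀ a b c d → a * b + (a * c + d) ≡ a * (b + c) + d
    factor = solve-∀

  -- This is the convolution formula with the search for pairs of exponents replaced by `⊖`. The
  -- ring laws below become inductions over the left factor.
  coeff-∷-* : ∀ a μ (p q : LPoly r) κ →
    coeff (((a , μ) ∷ p) *P q) κ ≡ a * coeff q (κ ⊖ μ) + coeff (p *P q) κ
  coeff-∷-* a μ p q κ = coeff-shift a μ _ (λ _ _ → refl) q (p *P q) κ

  *P-congˡ : (p : LPoly r) {q q′ : LPoly r} → q ≈ q′ → p *P q ≈ p *P q′
  *P-congˡ [] e κ = refl
  *P-congˡ ((a , μ) ∷ p) {q} {q′} e κ = begin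
    coeff (((a , μ) ∷ p) *P q) κ                  ≡⟨ coeff-∷-* a μ p q κ ⟩
    a * coeff q (κ ⊖ μ) + coeff (p *P q) κ    ≡⟨ cong₂ (λ u v → a * u + v) (e _) (*P-congˡ p e κ) ⟩
    a * coeff q′ (κ ⊖ μ) + coeff (p *P q′) κ  ≡⟨ coeff-∷-* a μ p q′ κ ⟨
    coeff (((a , μ) ∷ p) *P q′) κ                 ∎
    where open ≡.≡-Reasoning

  coeff-*-[] : (p : LPoly r) → p *P [] ≈ []
  coeff-*-[] [] κ = refl
  coeff-*-[] (_ ∷ p) κ = coeff-*-[] p κ

  -- The mirror image of `coeff-∷-*`; together they make commutativity an induction. The cross terms
  -- of the two heads are matched by `coeff₁-cross`.
  coeff-*-∷ : ∀ (q : LPoly r) a μ p κ →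
    coeff (q *P ((a , μ) ∷ p)) κ ≡ a * coeff q (κ ⊖ μ) + coeff (q *P p) κ
  coeff-*-∷ [] a μ p κ = sym (trans (ℤ.+-identityʳ _) (ℤ.*-zeroʳ a))
  coeff-*-∷ ((b , ν) ∷ q) a μ p κ = begin
    coeff (((b , ν) ∷ q) *P ((a , μ) ∷ p)) κ
      ≡⟨ coeff-∷-* b ν q ((a , μ) ∷ p) κ ⟩
    b * coeff ((a , μ) ∷ p) (κ ⊖ ν) + coeff (q *P ((a , μ) ∷ p)) κ
      ≡⟨ cong₂ (λ u v → b * u + v) (coeff-∷ a μ p _) (coeff-*-∷ q a μ p κ) ⟩
    b * (coeff₁ a μ (κ ⊖ ν) + P) + (a * Q + S)
      ≡⟨ expand b (coeff₁ a μ (κ ⊖ ν)) P (a * Q) S ⟩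
    b * coeff₁ a μ (κ ⊖ ν) + a * Q + (b * P + S)
      ≡⟨ cong (λ u → u + a * Q + (b * P + S)) (coeff₁-cross b a ν μ κ) ⟩
    a * coeff₁ b ν (κ ⊖ μ) + a * Q + (b * P + S)
      ≡⟨ cong₂ _+_
          (trans (sym (ℤ.*-distribˡ-+ a (coeff₁ b ν (κ ⊖ μ)) Q)) (cong (a *_) (sym (coeff-∷ b ν q _))))
          (sym (coeff-∷-* b ν q p κ)) ⟩
    a * coeff ((b , ν) ∷ q) (κ ⊖ μ) + coeff (((b , ν) ∷ q) *P p) κ ∎
    where
    open ≡.≡-Reasoning
    P = coeff p (κ ⊖ ν)
    Q = coeff q (κ ⊖ μ)
    S = coeff (q *P p) κ
    expand : ∀ b c P Q S → b * (c + P) + (Q + S) ≡ b * c + Q + (b * P + S)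
    expand = solve-∀

  *P-comm : (p q : LPoly r) → p *P q ≈ q *P p
  *P-comm [] q κ = sym (coeff-*-[] q κ)
  *P-comm ((a , μ) ∷ p) q κ = begin
    coeff (((a , μ) ∷ p) *P q) κ                ≡⟨ coeff-∷-* a μ p q κ ⟩
    a * coeff q (κ ⊖ μ) + coeff (p *P q) κ  ≡⟨ cong (a * coeff q (κ ⊖ μ) +_) (*P-comm p q κ) ⟩
    a * coeff q (κ ⊖ μ) + coeff (q *P p) κ  ≡⟨ coeff-*-∷ q a μ p κ ⟨
    coeff (q *P ((a , μ) ∷ p)) κ                ∎
    where open ≡.≡-Reasoning

  -- Equal coefficients give no relation between the lists `p` and `p′`, so induction on the left
  -- factor cannot compare them. Commutativity moves that factor to the right, where only its
  -- coefficients are used.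
  *P-cong : {p p′ q q′ : LPoly r} → p ≈ p′ → q ≈ q′ → p *P q ≈ p′ *P q′
  *P-cong {p = p} {p′} {q} {q′} e f κ = begin
    coeff (p *P q) κ    ≡⟨ *P-congˡ p f κ ⟩
    coeff (p *P q′) κ   ≡⟨ *P-comm p q′ κ ⟩
    coeff (q′ *P p) κ   ≡⟨ *P-congˡ q′ e κ ⟩
    coeff (q′ *P p′) κ  ≡⟨ *P-comm q′ p′ κ ⟩
    coeff (p′ *P q′) κ  ∎
    where open ≡.≡-Reasoning

  *P-distribʳ : (q p p′ : LPoly r) → (p +P p′) *P q ≈ (p *P q) +P (p′ *P q)
  *P-distribʳ q [] p′ κ = refl
  *P-distribʳ q ((a , μ) ∷ p) p′ κ = begin
    coeff (((a , μ) ∷ (p ++ p′)) *P q) κ                   ≡⟨ coeff-∷-* a μ (p ++ p′) q κ ⟩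
    A + coeff ((p ++ p′) *P q) κ                           ≡⟨ cong (A +_) (*P-distribʳ q p p′ κ) ⟩
    A + coeff ((p *P q) ++ (p′ *P q)) κ                    ≡⟨ cong (A +_) (coeff-++ (p *P q) (p′ *P q) κ) ⟩
    A + (coeff (p *P q) κ + coeff (p′ *P q) κ)             ≡⟨ ℤ.+-assoc A (coeff (p *P q) κ) (coeff (p′ *P q) κ) ⟨
    A + coeff (p *P q) κ + coeff (p′ *P q) κ               ≡⟨ cong (_+ coeff (p′ *P q) κ) (coeff-∷-* a μ p q κ) ⟨
    coeff (((a , μ) ∷ p) *P q) κ + coeff (p′ *P q) κ       ≡⟨ coeff-++ (((a , μ) ∷ p) *P q) (p′ *P q) κ ⟨
    coeff ((((a , μ) ∷ p) *P q) ++ (p′ *P q)) κ            ∎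
    where
    open ≡.≡-Reasoning
    A = a * coeff q (κ ⊖ μ)

  -- In a triple product the left factor is itself a mapped list; this lets associativity proceed
  -- one term of `p` at a time.
  shift-*P : ∀ a μ (F : ℤ × Exponent r → ℤ × Exponent r) →
    (∀ b ν → F (b , ν) ≡ (a * b , μ ⊕ ν)) →
    ∀ q p s κ → coeff ((List.map F q ++ p) *P s) κ ≡ a * coeff (q *P s) (κ ⊖ μ) + coeff (p *P s) κ
  shift-*P a μ F F≡ [] p s κ = sym (trans (cong (_+ coeff (p *P s) κ) (ℤ.*-zeroʳ a)) (ℤ.+-identityˡ _))
  shift-*P a μ F F≡ ((b , ν) ∷ q) p s κ rewrite F≡ b ν = begin
    coeff (((a * b , μ ⊕ ν) ∷ (List.map F q ++ p)) *P s) κ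
      ≡⟨ coeff-∷-* (a * b) (μ ⊕ ν) (List.map F q ++ p) s κ ⟩
    a * b * coeff s (κ ⊖ (μ ⊕ ν)) + coeff ((List.map F q ++ p) *P s) κ
      ≡⟨ cong₂ (λ u v → a * b * coeff s u + v) (⊖-⊕-assoc κ μ ν) (shift-*P a μ F F≡ q p s κ) ⟩
    a * b * coeff s (κ ⊖ μ ⊖ ν) + (a * coeff (q *P s) (κ ⊖ μ) + coeff (p *P s) κ)
      ≡⟨ factor a b (coeff s (κ ⊖ μ ⊖ ν)) (coeff (q *P s) (κ ⊖ μ)) (coeff (p *P s) κ) ⟩
    a * (b * coeff s (κ ⊖ μ ⊖ ν) + coeff (q *P s) (κ ⊖ μ)) + coeff (p *P s) κ
      ≡⟨ cong (λ u → a * u + coeff (p *P s) κ) (coeff-∷-* b ν q s (κ ⊖ μ)) ⟨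
    a * coeff (((b , ν) ∷ q) *P s) (κ ⊖ μ) + coeff (p *P s) κ ∎
    where
    open ≡.≡-Reasoning
    factor : ∀ a b c d e → a * b * c + (a * d + e) ≡ a * (b * c + d) + e
    factor = solve-∀

  *P-assoc : (p q s : LPoly r) → (p *P q) *P s ≈ p *P (q *P s)
  *P-assoc [] q s κ = refl
  *P-assoc ((a , μ) ∷ p) q s κ = begin
    coeff ((((a , μ) ∷ p) *P q) *P s) κ
      ≡⟨ shift-*P a μ _ (λ _ _ → refl) q (p *P q) s κ ⟩
    a * coeff (q *P s) (κ ⊖ μ) + coeff ((p *P q) *P s) κ
      ≡⟨ cong (a * coeff (q *P s) (κ ⊖ μ) +_) (*P-assoc p q s κ) ⟩
    a * coeff (q *P s) (κ ⊖ μ) + coeff (p *P (q *P s)) κ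
      ≡⟨ coeff-∷-* a μ p (q *P s) κ ⟨
    coeff (((a , μ) ∷ p) *P (q *P s)) κ ∎
    where open ≡.≡-Reasoning

  *P-identityˡ : (p : LPoly r) → 1P *P p ≈ p
  *P-identityˡ p κ = begin
    coeff (1P *P p) κ                      ≡⟨ coeff-∷-* 1ℤ (replicate _ 0ℤ) [] p κ ⟩
    1ℤ * coeff p (κ ⊖ replicate _ 0ℤ) + 0ℤ ≡⟨ ℤ.+-identityʳ _ ⟩
    1ℤ * coeff p (κ ⊖ replicate _ 0ℤ)    ≡⟨ ℤ.*-identityˡ _ ⟩
    coeff p (κ ⊖ replicate _ 0ℤ)           ≡⟨ cong (coeff p) (⊖-0 κ) ⟩
    coeff p κ                              ∎
    where open ≡.≡-Reasoning

  coeff-neg : (p : LPoly r) → ∀ κ → coeff (-P p) κ ≡ - coeff p κ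
  coeff-neg [] κ = refl
  coeff-neg ((a , μ) ∷ p) κ with does (μ ≟E κ)
  ... | true  = trans (cong (- a +_) (coeff-neg p κ)) (sym (ℤ.neg-distrib-+ a (coeff p κ)))
  ... | false = coeff-neg p κ

  +P-cong : {p p′ q q′ : LPoly r} → p ≈ p′ → q ≈ q′ → p +P q ≈ p′ +P q′
  +P-cong {p = p} {p′} {q} {q′} e f κ =
    trans (coeff-++ p q κ) (trans (cong₂ _+_ (e κ) (f κ)) (sym (coeff-++ p′ q′ κ)))

  +P-comm : (p q : LPoly r) → p +P q ≈ q +P p
  +P-comm p q κ = trans (coeff-++ p q κ)
    (trans (ℤ.+-comm (coeff p κ) (coeff q κ)) (sym (coeff-++ q p κ)))

  -P-inverseˡ : (p : LPoly r) → (-P p) +P p ≈ 0P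
  -P-inverseˡ p κ = trans (coeff-++ (-P p) p κ)
    (trans (cong (_+ coeff p κ) (coeff-neg p κ)) (ℤ.+-inverseˡ (coeff p κ)))

  lPolyRing : ℕ → CommutativeRing 0ℓ 0ℓ
  lPolyRing r = record
    { Carrier = LPoly r ; _≈_ = _≈_ ; _+_ = _+P_ ; _*_ = _*P_ ; -_ = -P_ ; 0# = 0P ; 1# = 1P
    ; isCommutativeRing = record
      { isRing = record
        { +-isAbelianGroup = record
          { isGroup = record
            { isMonoid = record
              { isSemigroup = record
                { isMagma = record
                  { isEquivalence = record
                    { refl = λ _ → refl ; sym = λ e κ → sym (e κ) ; trans = λ e f κ → trans (e κ) (f κ) }
                  ; ∙-cong = λ {p} {p′} {q} {q′} → +P-cong {p = p} {p′} {q} {q′} }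
                ; assoc = λ p q s κ → cong (λ u → coeff u κ) (List.++-assoc p q s) }
              ; identity = (λ _ _ → refl) , (λ p κ → cong (λ u → coeff u κ) (List.++-identityʳ p)) }
            ; inverse = -P-inverseˡ
                      , (λ p κ → trans (+P-comm p (-P p) κ) (-P-inverseˡ p κ))
            ; ⁻¹-cong = λ {p} {q} e κ →
                trans (coeff-neg p κ) (trans (cong -_ (e κ)) (sym (coeff-neg q κ))) }
          ; comm = +P-comm }
        ; *-cong = λ {p} {p′} {q} {q′} → *P-cong {p = p} {p′} {q} {q′}
        ; *-assoc = *P-assoc
        ; *-identity = *P-identityˡ , (λ p κ → trans (*P-comm p 1P κ) (*P-identityˡ p κ))
        ; distrib = (λ p q s κ → trans (*P-comm p (q +P s) κ) (trans (*P-distribʳ p q s κ)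
                      (+P-cong {p = q *P p} {p *P q} {s *P p} {p *P s} (*P-comm q p) (*P-comm s p) κ)))
                  , *P-distribʳ }
      ; *-comm = *P-comm } }

-- Words in the simple transpositions

inject₁≢suc : (i : Fin n) → inject₁ i ≢ suc i
inject₁≢suc (suc i) e = inject₁≢suc i (Fin.suc-injective e)

swapFun-inject₁ : (i : Fin n) → swapFun i (inject₁ i) ≡ suc i
swapFun-inject₁ i rewrite dec-true (inject₁ i Fin.≟ inject₁ i) refl = refl

swapFun-suc : (i : Fin n) → swapFun i (suc i) ≡ inject₁ i
swapFun-suc i
  rewrite dec-false (suc i Fin.≟ inject₁ i) (λ e → inject₁≢suc i (sym e))
        | dec-true (suc i Fin.≟ suc i) refl = refl

swapFun-other : (i : Fin n) {x : Fin (suc n)} → x ≢ inject₁ i → x ≢ suc i → swapFun i x ≡ x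
swapFun-other i {x} p q rewrite dec-false (x Fin.≟ inject₁ i) p | dec-false (x Fin.≟ suc i) q = refl

data SwapView (i : Fin n) : Fin (suc n) → Set where
  lower : SwapView i (inject₁ i)
  upper : SwapView i (suc i)
  other : ∀ {x} → x ≢ inject₁ i → x ≢ suc i → SwapView i x

swapView : (i : Fin n) (x : Fin (suc n)) → SwapView i x
swapView i x with x Fin.≟ inject₁ i | x Fin.≟ suc i
... | yes refl | _        = lower
... | no _     | yes refl = upper
... | no p     | no q     = other p q

swapFun-involutive : (i : Fin n) (x : Fin (suc n)) → swapFun i (swapFun i x) ≡ x
swapFun-involutive i x with swapView i x
... | lower     = trans (cong (swapFun i) (swapFun-inject₁ i)) (swapFun-suc i)
... | upper     = trans (cong (swapFun i) (swapFun-suc i)) (swapFun-inject₁ i)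
... | other p q = trans (cong (swapFun i) (swapFun-other i p q)) (swapFun-other i p q)

wordFun-injective : (ws : List (Fin n)) {x y : Fin (suc n)} → wordFun ws x ≡ wordFun ws y → x ≡ y
wordFun-injective [] e = e
wordFun-injective (i ∷ ws) {x} {y} e = wordFun-injective ws
  (trans (sym (swapFun-involutive i _)) (trans (cong (swapFun i) e) (swapFun-involutive i _)))

-- An adjacent transposition has exactly one inversion.
swapFun-flips : (i : Fin n) (a b : Fin (suc n)) → a Fin.< b → swapFun i b Fin.< swapFun i a →
  a ≡ inject₁ i × b ≡ suc i
swapFun-flips i a b a<b s with swapView i a | swapView i b
... | lower | lower = ⊥-elim (ℕ.<-irrefl refl a<b)
... | lower | upper = refl , refl
... | upper | upper = ⊥-elim (ℕ.<-irrefl refl a<b)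
... | upper | lower = ⊥-elim (ℕ.<-asym a<b (s≤s (ℕ.≤-reflexive (Fin.toℕ-inject₁ i))))
... | other p q | other p′ q′ =
  ⊥-elim (ℕ.<-asym a<b (subst₂ Fin._<_ (swapFun-other i p′ q′) (swapFun-other i p q) s))
... | lower | other p q = ⊥-elim (q (Fin.toℕ-injective (ℕ.≤-antisym b≤ (subst (ℕ._< Fin.toℕ b) (Fin.toℕ-inject₁ i) a<b))))
  where
  b≤ : Fin.toℕ b ℕ.≤ suc (Fin.toℕ i)
  b≤ = ℕ.<⇒≤ (subst₂ Fin._<_ (swapFun-other i p q) (swapFun-inject₁ i) s)
... | upper | other p q = ⊥-elim (ℕ.<-asym a<b (ℕ.<-≤-trans
  (subst₂ Fin._<_ (swapFun-other i p q) (swapFun-suc i) s)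
  (ℕ.≤-trans (ℕ.≤-reflexive (Fin.toℕ-inject₁ i)) (ℕ.n≤1+n _))))
... | other p q | upper = ⊥-elim (p (Fin.toℕ-injective (ℕ.≤-antisym
  (subst (Fin.toℕ a ℕ.≤_) (sym (Fin.toℕ-inject₁ i)) (ℕ.≤-pred a<b))
  (ℕ.<⇒≤ (subst₂ Fin._<_ (swapFun-suc i) (swapFun-other i p q) s)))))
... | other p q | lower = ⊥-elim (ℕ.<-asym a<b
  (ℕ.≤-trans (s≤s (ℕ.≤-trans (ℕ.≤-reflexive (Fin.toℕ-inject₁ i)) (ℕ.n≤1+n _)))
  (subst₂ Fin._<_ (swapFun-inject₁ i) (swapFun-other i p q) s)))

-- Strong exchange property, with the transposition (x y) replaced by its graph.
exchange : (ws : List (Fin n)) (x y : Fin (suc n)) → x Fin.< y → wordFun ws y Fin.< wordFun ws x →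
  ∃[ js ] length js ℕ.< length ws × wordFun js x ≡ wordFun ws y × wordFun js y ≡ wordFun ws x
        × (∀ u → u ≢ x → u ≢ y → wordFun js u ≡ wordFun ws u)
exchange [] x y x<y y<x = ⊥-elim (ℕ.<-asym x<y y<x)
exchange (i ∷ ws) x y x<y wy<wx with Fin.<-cmp (wordFun ws x) (wordFun ws y)
... | tri≈ _ e _ = ⊥-elim (ℕ.<-irrefl (cong Fin.toℕ (wordFun-injective ws e)) x<y)
... | tri> _ _ gt with js , lt , ex , ey , eu ← exchange ws x y x<y gt =
  i ∷ js , s≤s lt , cong (swapFun i) ex , cong (swapFun i) ey , λ u p q → cong (swapFun i) (eu u p q)
... | tri< lt _ _ with swapFun-flips i _ _ lt wy<wx
-- The letter `i` is the one that reverses the pair, so deleting it has the effect of transposing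
-- `x` and `y` beforehand.
... | a≡ , b≡ = ws , ℕ.n<1+n _
  , trans a≡ (trans (sym (swapFun-suc i)) (cong (swapFun i) (sym b≡)))
  , trans b≡ (trans (sym (swapFun-inject₁ i)) (cong (swapFun i) (sym a≡)))
  , λ u p q → sym (swapFun-other i
      (λ e → p (wordFun-injective ws (trans e (sym a≡))))
      (λ e → q (wordFun-injective ws (trans e (sym b≡)))))

-- Were `y < x`, exchange would give a word shorter than `ws` for `ws` preceded by the transposition
-- of `x` and `y`. As these are sent to `suc i` and `inject₁ i` in some order, that is the
-- permutation of `i ∷ ws`, against minimality.
reduced⇒ascent : (i : Fin n) (ws : List (Fin n)) →
  (∀ js → (∀ x → wordFun (i ∷ ws) x ≡ wordFun js x) → length (i ∷ ws) ℕ.≤ length js) →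
  ∀ x y → wordFun ws x ≡ inject₁ i → wordFun ws y ≡ suc i → x Fin.< y
reduced⇒ascent i ws minimal x y wx wy with Fin.<-cmp x y
... | tri< lt _ _ = lt
... | tri≈ _ refl _ = ⊥-elim (inject₁≢suc i (trans (sym wx) wy))
... | tri> _ _ gt with exchange ws y x gt
        (subst₂ Fin._<_ (sym wx) (sym wy) (s≤s (ℕ.≤-reflexive (Fin.toℕ-inject₁ i))))
... | js , lt , ey , ex , eu = ⊥-elim (ℕ.<-asym lt (minimal js agree))
  where
  agree : ∀ u → swapFun i (wordFun ws u) ≡ wordFun js u
  agree u with u Fin.≟ x | u Fin.≟ y
  ... | yes refl | _ = trans (cong (swapFun i) wx) (trans (swapFun-inject₁ i) (trans (sym wy) (sym ex)))
  ... | no _ | yes refl = trans (cong (swapFun i) wy) (trans (swapFun-suc i) (trans (sym wx) (sym ey)))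
  ... | no p | no q = trans
    (swapFun-other i (λ e → p (wordFun-injective ws (trans e (sym wx))))
                     (λ e → q (wordFun-injective ws (trans e (sym wy)))))
    (sym (eu u q p))

-- The Yang–Baxter equation

module _ {r : ℕ} where

  cmax-≤ : {c d : Fin r} → c Fin.≤ d → cmax c d ≡ c
  cmax-≤ {c} {d} le rewrite dec-true (toℕ c ℕ.≤? toℕ d) le = refl

  cmin-≤ : {c d : Fin r} → c Fin.≤ d → cmin c d ≡ d
  cmin-≤ {c} {d} le rewrite dec-true (toℕ c ℕ.≤? toℕ d) le = refl

  -- Larger colors have smaller indices, hence the minimum. Identities between colors are thereby
  -- transported to the distributive lattice ℕ.
  toℕ-cmax : (c d : Fin r) → toℕ (cmax c d) ≡ toℕ c ⊓ toℕ d
  toℕ-cmax c d with toℕ c ℕ.≤? toℕ d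
  ... | yes le = ≡.trans (cong toℕ (cmax-≤ le)) (≡.sym (ℕ.m≤n⇒m⊓n≡m le))
  ... | no ¬le rewrite dec-false (toℕ c ℕ.≤? toℕ d) ¬le = ≡.sym (ℕ.m≥n⇒m⊓n≡n (ℕ.≰⇒≥ ¬le))

  toℕ-cmin : (c d : Fin r) → toℕ (cmin c d) ≡ toℕ c ⊔ toℕ d
  toℕ-cmin c d with toℕ c ℕ.≤? toℕ d
  ... | yes le = ≡.trans (cong toℕ (cmin-≤ le)) (≡.sym (ℕ.m≤n⇒m⊔n≡n le))
  ... | no ¬le rewrite dec-false (toℕ c ℕ.≤? toℕ d) ¬le = ≡.sym (ℕ.m≥n⇒m⊔n≡m (ℕ.≰⇒≥ ¬le))

  cmax-comm : (c d : Fin r) → cmax c d ≡ cmax d c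
  cmax-comm c d = Fin.toℕ-injective
    (≡.trans (toℕ-cmax c d) (≡.trans (ℕ.⊓-comm (toℕ c) (toℕ d)) (≡.sym (toℕ-cmax d c))))

  cmin-comm : (c d : Fin r) → cmin c d ≡ cmin d c
  cmin-comm c d = Fin.toℕ-injective
    (≡.trans (toℕ-cmin c d) (≡.trans (ℕ.⊔-comm (toℕ c) (toℕ d)) (≡.sym (toℕ-cmin d c))))

  cmax-≤-cmin : (c d : Fin r) → cmax c d Fin.≤ cmin c d
  cmax-≤-cmin c d = ≡.subst₂ ℕ._≤_ (≡.sym (toℕ-cmax c d)) (≡.sym (toℕ-cmin c d))
    (ℕ.≤-trans (ℕ.m⊓n≤m (toℕ c) (toℕ d)) (ℕ.m≤m⊔n (toℕ c) (toℕ d)))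

  module _ (a b t : Fin r) where
    open ≡.≡-Reasoning

    -- The three outputs sort {a , b , t}, whichever pair is compared first.
    sort₃-max : cmax (cmax a t) (cmax b (cmin a t)) ≡ cmax (cmax a b) t
    sort₃-max = Fin.toℕ-injective (begin
      toℕ (cmax (cmax a t) (cmax b (cmin a t)))
        ≡⟨ ≡.trans (toℕ-cmax (cmax a t) _) (cong₂ _⊓_ (toℕ-cmax a t)
             (≡.trans (toℕ-cmax b _) (cong (toℕ b ⊓_) (toℕ-cmin a t)))) ⟩
      (toℕ a ⊓ toℕ t) ⊓ (toℕ b ⊓ (toℕ a ⊔ toℕ t))   ≡⟨ lemma (toℕ a) (toℕ b) (toℕ t) ⟩
      (toℕ a ⊓ toℕ b) ⊓ toℕ t
        ≡⟨ ≡.trans (toℕ-cmax (cmax a b) t) (cong (_⊓ toℕ t) (toℕ-cmax a b)) ⟨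
      toℕ (cmax (cmax a b) t) ∎)
      where
      lemma : ∀ a b t → (a ⊓ t) ⊓ (b ⊓ (a ⊔ t)) ≡ (a ⊓ b) ⊓ t
      lemma a b t = begin
        (a ⊓ t) ⊓ (b ⊓ (a ⊔ t))   ≡⟨ cong ((a ⊓ t) ⊓_) (ℕ.⊓-comm b (a ⊔ t)) ⟩
        (a ⊓ t) ⊓ ((a ⊔ t) ⊓ b)   ≡⟨ ℕ.⊓-assoc (a ⊓ t) (a ⊔ t) b ⟨
        ((a ⊓ t) ⊓ (a ⊔ t)) ⊓ b
          ≡⟨ cong (_⊓ b) (ℕ.m≤n⇒m⊓n≡m (ℕ.≤-trans (ℕ.m⊓n≤m a t) (ℕ.m≤m⊔n a t))) ⟩
        (a ⊓ t) ⊓ b               ≡⟨ ℕ.⊓-assoc a t b ⟩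
        a ⊓ (t ⊓ b)               ≡⟨ cong (a ⊓_) (ℕ.⊓-comm t b) ⟩
        a ⊓ (b ⊓ t)               ≡⟨ ℕ.⊓-assoc a b t ⟨
        (a ⊓ b) ⊓ t               ∎

    sort₃-med : cmin (cmax a t) (cmax b (cmin a t)) ≡ cmax (cmin a b) (cmin (cmax a b) t)
    sort₃-med = Fin.toℕ-injective (begin
      toℕ (cmin (cmax a t) (cmax b (cmin a t)))
        ≡⟨ ≡.trans (toℕ-cmin (cmax a t) _) (cong₂ _⊔_ (toℕ-cmax a t)
             (≡.trans (toℕ-cmax b _) (cong (toℕ b ⊓_) (toℕ-cmin a t)))) ⟩
      (toℕ a ⊓ toℕ t) ⊔ (toℕ b ⊓ (toℕ a ⊔ toℕ t))   ≡⟨ lemma (toℕ a) (toℕ b) (toℕ t) ⟩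
      (toℕ a ⊔ toℕ b) ⊓ ((toℕ a ⊓ toℕ b) ⊔ toℕ t)
        ≡⟨ ≡.trans (toℕ-cmax (cmin a b) _) (cong₂ _⊓_ (toℕ-cmin a b)
             (≡.trans (toℕ-cmin _ t) (cong (_⊔ toℕ t) (toℕ-cmax a b)))) ⟨
      toℕ (cmax (cmin a b) (cmin (cmax a b) t)) ∎)
      where
      lemma : ∀ a b t → (a ⊓ t) ⊔ (b ⊓ (a ⊔ t)) ≡ (a ⊔ b) ⊓ ((a ⊓ b) ⊔ t)
      lemma a b t = begin
        (a ⊓ t) ⊔ (b ⊓ (a ⊔ t))               ≡⟨ ℕ.⊔-distribˡ-⊓ (a ⊓ t) b (a ⊔ t) ⟩
        ((a ⊓ t) ⊔ b) ⊓ ((a ⊓ t) ⊔ (a ⊔ t))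
          ≡⟨ cong₂ _⊓_ (ℕ.⊔-distribʳ-⊓ b a t)
               (ℕ.m≤n⇒m⊔n≡n (ℕ.≤-trans (ℕ.m⊓n≤m a t) (ℕ.m≤m⊔n a t))) ⟩
        ((a ⊔ b) ⊓ (t ⊔ b)) ⊓ (a ⊔ t)         ≡⟨ ℕ.⊓-assoc (a ⊔ b) (t ⊔ b) (a ⊔ t) ⟩
        (a ⊔ b) ⊓ ((t ⊔ b) ⊓ (a ⊔ t))         ≡⟨ cong ((a ⊔ b) ⊓_) (ℕ.⊓-comm (t ⊔ b) (a ⊔ t)) ⟩
        (a ⊔ b) ⊓ ((a ⊔ t) ⊓ (t ⊔ b))         ≡⟨ cong (λ u → (a ⊔ b) ⊓ ((a ⊔ t) ⊓ u)) (ℕ.⊔-comm t b) ⟩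
        (a ⊔ b) ⊓ ((a ⊔ t) ⊓ (b ⊔ t))         ≡⟨ cong ((a ⊔ b) ⊓_) (ℕ.⊔-distribʳ-⊓ t a b) ⟨
        (a ⊔ b) ⊓ ((a ⊓ b) ⊔ t)               ∎

    sort₃-min : cmin b (cmin a t) ≡ cmin (cmin a b) (cmin (cmax a b) t)
    sort₃-min = Fin.toℕ-injective (begin
      toℕ (cmin b (cmin a t))
        ≡⟨ ≡.trans (toℕ-cmin b _) (cong (toℕ b ⊔_) (toℕ-cmin a t)) ⟩
      toℕ b ⊔ (toℕ a ⊔ toℕ t)   ≡⟨ lemma (toℕ a) (toℕ b) (toℕ t) ⟩
      (toℕ a ⊔ toℕ b) ⊔ ((toℕ a ⊓ toℕ b) ⊔ toℕ t)
        ≡⟨ ≡.trans (toℕ-cmin (cmin a b) _) (cong₂ _⊔_ (toℕ-cmin a b)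
             (≡.trans (toℕ-cmin _ t) (cong (_⊔ toℕ t) (toℕ-cmax a b)))) ⟨
      toℕ (cmin (cmin a b) (cmin (cmax a b) t)) ∎)
      where
      lemma : ∀ a b t → b ⊔ (a ⊔ t) ≡ (a ⊔ b) ⊔ ((a ⊓ b) ⊔ t)
      lemma a b t = begin
        b ⊔ (a ⊔ t)                   ≡⟨ ℕ.⊔-assoc b a t ⟨
        (b ⊔ a) ⊔ t                   ≡⟨ cong (_⊔ t) (ℕ.⊔-comm b a) ⟩
        (a ⊔ b) ⊔ t
          ≡⟨ cong (_⊔ t) (ℕ.m≥n⇒m⊔n≡m (ℕ.≤-trans (ℕ.m⊓n≤m a b) (ℕ.m≤m⊔n a b))) ⟨
        ((a ⊔ b) ⊔ (a ⊓ b)) ⊔ t       ≡⟨ ℕ.⊔-assoc (a ⊔ b) (a ⊓ b) t ⟩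
        (a ⊔ b) ⊔ ((a ⊓ b) ⊔ t)       ∎

-- Rows as functionals, the R-matrix, and the exchange of two adjacent rows

module Lattice {c ℓ} (R : CommutativeRing c ℓ) (r : ℕ) where

  open CommutativeRing R using (Carrier; _+_; _*_; 0#; 1#; setoid; commutativeSemiring; +-cong; *-cong;
    +-identityʳ; zeroˡ; zeroʳ; distribˡ; distribʳ; *-assoc; *-comm; semiring)
    renaming (_≈_ to _≋_; refl to ≋-refl; sym to ≋-sym; trans to ≋-trans; reflexive to ≋-reflexive)
  open import Relation.Binary.Reasoning.Setoid setoid
  open Solver commutativeSemiring using (solve; _:=_; _:+_; _:*_; con)

  private
    S : Set
    S = Spin r

    variable
      C : ℕ

  ι : Bool → Carrier
  ι b = if b then 1# else 0#

  -- vertex x l t φ sums φ, weighted, over the possible (right , bottom) spins; row and grid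
  -- iterate this.  The head of a vector of spins is the rightmost column.
  vertex : Carrier → S → S → (S → S → Carrier) → Carrier
  vertex x nothing  nothing  φ = φ nothing nothing
  vertex x nothing  (just d) φ = φ (just d) nothing
  vertex x (just c) nothing  φ = x * (φ (just c) nothing + φ nothing (just c))
  vertex x (just c) (just d) φ = x * φ (just (cmax c d)) (just (cmin c d))

  row : Carrier → Vec S C → (S → Vec S C → Carrier) → Carrier
  row x []      φ = φ nothing []
  row x (t ∷ T) φ = row x T (λ l V → vertex x l t (λ a b → φ a (b ∷ V)))

  vacant : Vec S C → Bool
  vacant []      = true
  vacant (t ∷ T) = does (t ≟S nothing) ∧ vacant T

  grid : ∀ m → (Fin m → Carrier) → (Fin m → Fin r) → Vec S C → Carrier
  grid zero    z σ T = ι (vacant T)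
  grid (suc m) z σ T = row (z zero) T
    (λ a V → ι (does (a ≟S just (σ zero))) * grid m (z ∘ suc) (σ ∘ suc) V)

  vertex-cong : ∀ {x x′} l t {φ ψ} → x ≋ x′ → (∀ a b → φ a b ≋ ψ a b) →
    vertex x l t φ ≋ vertex x′ l t ψ
  vertex-cong nothing  nothing  e h = h _ _
  vertex-cong nothing  (just d) e h = h _ _
  vertex-cong (just c) nothing  e h = *-cong e (+-cong (h _ _) (h _ _))
  vertex-cong (just c) (just d) e h = *-cong e (h _ _)

  row-cong : ∀ {x x′} (T : Vec S C) {φ ψ} → x ≋ x′ → (∀ a V → φ a V ≋ ψ a V) →
    row x T φ ≋ row x′ T ψ
  row-cong []      e h = h _ _
  row-cong (t ∷ T) e h = row-cong T e (λ l V → vertex-cong l t e (λ a b → h a (b ∷ V)))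

  grid-cong : ∀ m {z z′ σ σ′} (T : Vec S C) → (∀ k → z k ≋ z′ k) → (∀ k → σ k ≡ σ′ k) →
    grid m z σ T ≋ grid m z′ σ′ T
  grid-cong zero    T hz hσ = ≋-refl
  grid-cong (suc m) T hz hσ = row-cong T (hz zero) (λ a V → *-cong
    (≋-reflexive (cong (λ s → ι (does (a ≟S just s))) (hσ zero)))
    (grid-cong m V (hz ∘ suc) (hσ ∘ suc)))

  vertex-+ : ∀ x l t φ ψ → vertex x l t (λ a b → φ a b + ψ a b) ≋ vertex x l t φ + vertex x l t ψ
  vertex-+ x nothing  nothing  φ ψ = ≋-refl
  vertex-+ x nothing  (just d) φ ψ = ≋-refl
  vertex-+ x (just c) nothing  φ ψ = solve 5 (λ x a b a′ b′ →
    x :* ((a :+ b) :+ (a′ :+ b′)) := x :* (a :+ a′) :+ x :* (b :+ b′)) ≋-refl x _ _ _ _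
  vertex-+ x (just c) (just d) φ ψ = distribˡ x _ _

  vertex-* : ∀ x l t k φ → vertex x l t (λ a b → k * φ a b) ≋ k * vertex x l t φ
  vertex-* x nothing  nothing  k φ = ≋-refl
  vertex-* x nothing  (just d) k φ = ≋-refl
  vertex-* x (just c) nothing  k φ = solve 4 (λ x k a b →
    x :* (k :* a :+ k :* b) := k :* (x :* (a :+ b))) ≋-refl x k _ _
  vertex-* x (just c) (just d) k φ = solve 3 (λ x k a → x :* (k :* a) := k :* (x :* a)) ≋-refl x k _

  row-+ : ∀ x (T : Vec S C) φ ψ → row x T (λ a V → φ a V + ψ a V) ≋ row x T φ + row x T ψ
  row-+ x []      φ ψ = ≋-refl
  row-+ x (t ∷ T) φ ψ = ≋-trans (row-cong T ≋-refl (λ l V → vertex-+ x l t _ _)) (row-+ x T _ _)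

  row-* : ∀ x (T : Vec S C) k φ → row x T (λ a V → k * φ a V) ≋ k * row x T φ
  row-* x []      k φ = ≋-refl
  row-* x (t ∷ T) k φ = ≋-trans (row-cong T ≋-refl (λ l V → vertex-* x l t k _)) (row-* x T k _)

  -- A vertex of the upper row shares no edge with the lower row in the columns to its left, so the
  -- two can be evaluated in either order. This regroups two rows into columns.
  row-vertex-comm : ∀ x y l t (V : Vec S C) (f : S → S → S → Vec S C → Carrier) →
    vertex x l t (λ a m → row y V (f a m)) ≋ row y V (λ l′ W → vertex x l t (λ a m → f a m l′ W))
  row-vertex-comm x y nothing  nothing  V f = ≋-refl
  row-vertex-comm x y nothing  (just d) V f = ≋-refl
  row-vertex-comm x y (just c) nothing  V f =
    ≋-trans (*-cong ≋-refl (≋-sym (row-+ y V _ _))) (≋-sym (row-* y V x _))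
  row-vertex-comm x y (just c) (just d) V f = ≋-sym (row-* y V x _)

  column : Carrier → Carrier → S → S → S → (S → S → S → Carrier) → Carrier
  column x y l₁ l₂ t φ = vertex x l₁ t (λ p m → vertex y l₂ m (λ q b → φ p q b))

  rows : Carrier → Carrier → Vec S C → (S → S → Vec S C → Carrier) → Carrier
  rows x y T φ = row x T (λ p V → row y V (λ q W → φ p q W))

  rows-∷ : ∀ x y t (T : Vec S C) φ → rows x y (t ∷ T) φ ≋
    rows x y T (λ l₁ l₂ W → column x y l₁ l₂ t (λ p q b → φ p q (b ∷ W)))
  rows-∷ x y t T φ = row-cong T ≋-refl (λ l₁ V → row-vertex-comm x y l₁ t V
    (λ p m l₂ W → vertex y l₂ m (λ q b → φ p q (b ∷ W))))

  rows-cong : ∀ {x x′ y y′} (T : Vec S C) {φ ψ} → x ≋ x′ → y ≋ y′ →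
    (∀ p q W → φ p q W ≋ ψ p q W) → rows x y T φ ≋ rows x′ y′ T ψ
  rows-cong T e f h = row-cong T e (λ p V → row-cong V f (h p))

  -- The R-matrix for the row parameters x and y = x + d, acting on the pair of
  -- horizontal spins; the difference d = y - x is a parameter so that every
  -- identity below lives in a commutative semiring.
  braid : Carrier → Carrier → S → S → (S → S → Carrier) → Carrier
  braid x d nothing  nothing  φ = x * φ nothing nothing
  braid x d nothing  (just c) φ = (x + d) * φ nothing (just c) + d * φ (just c) nothing
  braid x d (just c) nothing  φ = x * φ (just c) nothing
  braid x d (just p) (just q) φ = x * φ (just p) (just q) + d * φ (just (cmax p q)) (just (cmin p q))

  braid-cong : ∀ x d p q {φ ψ} → (∀ p q → φ p q ≋ ψ p q) → braid x d p q φ ≋ braid x d p q ψ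
  braid-cong x d nothing  nothing  h = *-cong ≋-refl (h _ _)
  braid-cong x d nothing  (just _) h = +-cong (*-cong ≋-refl (h _ _)) (*-cong ≋-refl (h _ _))
  braid-cong x d (just _) nothing  h = *-cong ≋-refl (h _ _)
  braid-cong x d (just _) (just _) h = +-cong (*-cong ≋-refl (h _ _)) (*-cong ≋-refl (h _ _))

  -- Since `φ` is arbitrary, all outgoing spins are treated at once and one identity per triple
  -- `l₁`, `l₂`, `t` remains. The rewrites bring sorted colors to a common form, so that equal
  -- values of `φ` become equal atoms for the solver.
  yang-baxter : ∀ x d l₁ l₂ t φ →
    column x (x + d) l₁ l₂ t (λ p q b → braid x d p q (λ p q → φ p q b)) ≋
    braid x d l₁ l₂ (λ l₁ l₂ → column (x + d) x l₁ l₂ t φ)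
  yang-baxter x d nothing nothing nothing φ = ≋-refl
  yang-baxter x d nothing nothing (just e) φ = ≋-refl
  yang-baxter x d (just c) nothing nothing φ = solve 4 (λ x d A B →
    x :* (x :* A :+ ((x :+ d) :* B :+ d :* A)) := x :* ((x :+ d) :* (A :+ B)))
    ≋-refl x d _ _
  yang-baxter x d nothing (just c) nothing φ = solve 5 (λ x d A B D →
    (x :+ d) :* (((x :+ d) :* A :+ d :* B) :+ x :* D) :=
    (x :+ d) :* (x :* (A :+ D)) :+ d :* ((x :+ d) :* (B :+ A)))
    ≋-refl x d _ _ _
  -- The two colors leave the column already sorted, so both terms of `braid` coincide.
  yang-baxter x d (just c) nothing (just e) φ
    rewrite cmax-≤ (cmax-≤-cmin c e) | cmin-≤ (cmax-≤-cmin c e) = solve 3 (λ x d A →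
    x :* (x :* A :+ d :* A) := x :* ((x :+ d) :* A))
    ≋-refl x d _
  yang-baxter x d nothing (just c) (just e) φ
    rewrite cmax-comm c e | cmin-comm c e = solve 5 (λ x d A B D →
    (x :+ d) :* ((x :* A :+ d :* B) :+ x :* D) :=
    (x :+ d) :* (x :* (A :+ D)) :+ d :* ((x :+ d) :* B))
    ≋-refl x d _ _ _
  yang-baxter x d (just c) (just e) nothing φ
    rewrite cmax-comm e c | cmin-comm e c
          | cmax-comm (cmin c e) (cmax c e) | cmin-comm (cmin c e) (cmax c e)
          | cmax-≤ (cmax-≤-cmin c e) | cmin-≤ (cmax-≤-cmin c e) = solve 7 (λ x d A B D E F →
    x :* ((x :+ d) :* ((x :* A :+ d :* B) :+ x :* D) :+ (x :+ d) :* ((x :+ d) :* E :+ d :* F)) :=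
    x :* ((x :+ d) :* (x :* (A :+ D) :+ x :* E)) :+ d :* ((x :+ d) :* (x :* (B :+ F) :+ x :* E)))
    ≋-refl x d _ _ _ _ _
  yang-baxter x d (just a) (just b) (just t) φ
    rewrite sort₃-max a b t | sort₃-med a b t | ≡.sym (sort₃-min a b t) = solve 4 (λ x d A B →
    x :* ((x :+ d) :* (x :* A :+ d :* B)) :=
    x :* ((x :+ d) :* (x :* A)) :+ d :* ((x :+ d) :* (x :* B)))
    ≋-refl x d _ _

  rows-braid : ∀ x d (T : Vec S C) φ →
    rows x (x + d) T (λ p q W → braid x d p q (λ p q → φ p q W)) ≋ x * rows (x + d) x T φ
  -- At the left boundary both spins are +, where `braid` is multiplication by `x`; this is the
  -- factor on the right-hand side.
  rows-braid x d []      φ = ≋-refl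
  rows-braid x d (t ∷ T) φ = begin
    rows x (x + d) (t ∷ T) (λ p q W → braid x d p q (λ p q → φ p q W))
      ≈⟨ rows-∷ x (x + d) t T (λ p q W → braid x d p q (λ p q → φ p q W)) ⟩
    rows x (x + d) T (λ l₁ l₂ W → column x (x + d) l₁ l₂ t (λ p q b → braid x d p q (λ p q → φ p q (b ∷ W))))
      ≈⟨ rows-cong T ≋-refl ≋-refl (λ l₁ l₂ W → yang-baxter x d l₁ l₂ t (λ p q b → φ p q (b ∷ W))) ⟩
    rows x (x + d) T (λ l₁ l₂ W → braid x d l₁ l₂ (λ l₁ l₂ → column (x + d) x l₁ l₂ t (λ p q b → φ p q (b ∷ W))))
      ≈⟨ rows-braid x d T _ ⟩
    x * rows (x + d) x T (λ l₁ l₂ W → column (x + d) x l₁ l₂ t (λ p q b → φ p q (b ∷ W)))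
      ≈⟨ *-cong ≋-refl (≋-sym (rows-∷ (x + d) x t T φ)) ⟩
    x * rows (x + d) x (t ∷ T) φ ∎

  ι-≟-refl : (s : S) → ι (does (s ≟S s)) ≡ 1#
  ι-≟-refl s rewrite dec-true (s ≟S s) refl = refl

  ι-≟-≢ : {s t : S} → s ≢ t → ι (does (s ≟S t)) ≡ 0#
  ι-≟-≢ {s} {t} ne rewrite dec-false (s ≟S t) ne = refl

  private
    δ : S → Fin r → Carrier
    δ s c = ι (does (s ≟S just c))

    δ-≢ : {p c : Fin r} → p ≢ c → δ (just p) c ≡ 0#
    δ-≢ ne = ι-≟-≢ (λ e → ne (Maybe.just-injective e))

    δ*δ-≢ : {p q c e : Fin r} → (p ≡ c → q ≢ e) → δ (just p) c * δ (just q) e ≋ 0#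
    δ*δ-≢ {p} {q} {c} {e} ne = by-cases (p Fin.≟ c)
      where
      by-cases : Dec (p ≡ c) → δ (just p) c * δ (just q) e ≋ 0#
      by-cases (no p≢c)  = ≋-trans (*-cong (≋-reflexive (δ-≢ p≢c)) ≋-refl) (zeroˡ _)
      by-cases (yes p≡c) = ≋-trans (*-cong ≋-refl (≋-reflexive (δ-≢ (ne p≡c)))) (zeroʳ _)

  -- Testing the output of the R-matrix against the exits (c , e), c the larger color.
  braid-δ : ∀ x d {c e : Fin r} → c Fin.< e → ∀ p q →
    braid x d p q (λ p q → δ p c * δ q e) ≋ (x + d) * (δ p c * δ q e) + d * (δ p e * δ q c)
  braid-δ x d c<e nothing  nothing  = solve 2 (λ x d →
    x :* (con 0 :* con 0) := (x :+ d) :* (con 0 :* con 0) :+ d :* (con 0 :* con 0)) ≋-refl x d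
  braid-δ x d {c} {e} c<e nothing  (just q) = solve 4 (λ x d A B →
    (x :+ d) :* (con 0 :* A) :+ d :* (B :* con 0) := (x :+ d) :* (con 0 :* A) :+ d :* (con 0 :* B))
    ≋-refl x d (δ (just q) e) (δ (just q) c)
  braid-δ x d {c} {e} c<e (just p) nothing  = solve 4 (λ x d A B →
    x :* (A :* con 0) := (x :+ d) :* (A :* con 0) :+ d :* (B :* con 0))
    ≋-refl x d (δ (just p) c) (δ (just p) e)
  braid-δ x d {c} {e} c<e (just p) (just q) with ℕ.≤-total (toℕ p) (toℕ q)
  -- The pair is already sorted: the two terms agree and add up to `x + d`, while the test at
  -- `(e , c)` would contradict `c < e`.
  ... | inj₁ p≤q rewrite cmax-≤ {c = p} {q} p≤q | cmin-≤ {c = p} {q} p≤q = begin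
    x * P + d * P              ≈⟨ distribʳ P x d ⟨
    (x + d) * P                ≈⟨ +-identityʳ _ ⟨
    (x + d) * P + 0#           ≈⟨ +-cong ≋-refl (≋-trans (*-cong ≋-refl vanish) (zeroʳ d)) ⟨
    (x + d) * P + d * (δ (just p) e * δ (just q) c) ∎
    where
    P = δ (just p) c * δ (just q) e
    vanish : δ (just p) e * δ (just q) c ≋ 0#
    vanish = δ*δ-≢ {p} {q} {e} {c} (λ { refl refl → ℕ.<⇒≱ c<e p≤q })
  -- Sorting gives `q , p`, so the `d` term becomes the test at `(e , c)`. As `P` vanishes, its
  -- coefficient may change from `x` to `x + d`.
  ... | inj₂ q≤p rewrite cmax-comm p q | cmin-comm p q | cmax-≤ {c = q} {p} q≤p | cmin-≤ {c = q} {p} q≤p = begin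
    x * P + d * (δ (just q) c * δ (just p) e)
      ≈⟨ +-cong (zero-out x) (*-cong ≋-refl (*-comm _ _)) ⟩
    0# + d * (δ (just p) e * δ (just q) c)
      ≈⟨ +-cong (zero-out (x + d)) ≋-refl ⟨
    (x + d) * P + d * (δ (just p) e * δ (just q) c) ∎
    where
    P = δ (just p) c * δ (just q) e
    vanish : P ≋ 0#
    vanish = δ*δ-≢ {p} {q} {c} {e} (λ { refl refl → ℕ.<⇒≱ c<e q≤p })
    zero-out : ∀ k → k * P ≋ 0#
    zero-out k = ≋-trans (*-cong ≋-refl vanish) (zeroʳ k)

  rows-+ : ∀ x y (T : Vec S C) φ ψ →
    rows x y T (λ p q W → φ p q W + ψ p q W) ≋ rows x y T φ + rows x y T ψ
  rows-+ x y T φ ψ = ≋-trans (row-cong T ≋-refl (λ p V → row-+ y V _ _)) (row-+ x T _ _)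

  rows-* : ∀ x y (T : Vec S C) k φ → rows x y T (λ p q W → k * φ p q W) ≋ k * rows x y T φ
  rows-* x y T k φ = ≋-trans (row-cong T ≋-refl (λ p V → row-* y V k _)) (row-* x T k _)

  braid-*ʳ : ∀ x d p q φ k → braid x d p q (λ p q → φ p q * k) ≋ braid x d p q φ * k
  braid-*ʳ x d nothing  nothing  φ k = ≋-sym (*-assoc _ _ _)
  braid-*ʳ x d nothing  (just _) φ k = solve 5 (λ x d A B k →
    (x :+ d) :* (A :* k) :+ d :* (B :* k) := ((x :+ d) :* A :+ d :* B) :* k) ≋-refl x d _ _ k
  braid-*ʳ x d (just _) nothing  φ k = ≋-sym (*-assoc _ _ _)
  braid-*ʳ x d (just _) (just _) φ k = solve 5 (λ x d A B k →
    x :* (A :* k) :+ d :* (B :* k) := (x :* A :+ d :* B) :* k) ≋-refl x d _ _ k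

  grid-rows : ∀ m z σ (T : Vec S C) → grid (suc (suc m)) z σ T ≋
    rows (z zero) (z (suc zero)) T (λ p q W →
      δ p (σ zero) * δ q (σ (suc zero)) * grid m (λ k → z (suc (suc k))) (λ k → σ (suc (suc k))) W)
  grid-rows m z σ T = row-cong T ≋-refl (λ p V → ≋-trans (≋-sym (row-* _ V _ _))
    (row-cong V ≋-refl (λ q W → ≋-sym (*-assoc _ _ _))))

  swapFun-suc-suc : ∀ {n} (i : Fin n) x → swapFun (suc i) (suc x) ≡ suc (swapFun i x)
  swapFun-suc-suc i x with does (x Fin.≟ inject₁ i) | does (x Fin.≟ suc i)
  ... | true  | _     = refl
  ... | false | true  = refl
  ... | false | false = refl

  -- The coefficients on the left come from `braid-δ` at the right boundary, the one on the right
  -- from `braid` on two + spins at the left boundary.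
  grid-swap : ∀ {n} (i : Fin n) z σ (T : Vec S C) d →
    σ (inject₁ i) Fin.< σ (suc i) → z (inject₁ i) + d ≋ z (suc i) →
    z (suc i) * grid (suc n) z σ T + d * grid (suc n) z (σ ∘ swapFun i) T ≋
    z (inject₁ i) * grid (suc n) (z ∘ swapFun i) σ T
  grid-swap {n = suc n} zero z σ T d c<e x+d≋y = begin
    y * grid (suc (suc n)) z σ T + d * grid (suc (suc n)) z (σ ∘ swapFun zero) T
      ≈⟨ +-cong (*-cong (≋-sym x+d≋y) (≋-trans (grid-rows n z σ T)
                  (rows-cong T ≋-refl (≋-sym x+d≋y) (λ p q W → ≋-refl))))
                (*-cong ≋-refl (≋-trans (grid-rows n z (σ ∘ swapFun zero) T)
                  (rows-cong T ≋-refl (≋-sym x+d≋y) (λ p q W → ≋-refl)))) ⟩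
    (x + d) * rows x (x + d) T φ + d * rows x (x + d) T ψ
      ≈⟨ +-cong (rows-* x (x + d) T (x + d) φ) (rows-* x (x + d) T d ψ) ⟨
    rows x (x + d) T (λ p q W → (x + d) * φ p q W) + rows x (x + d) T (λ p q W → d * ψ p q W)
      ≈⟨ rows-+ x (x + d) T _ _ ⟨
    rows x (x + d) T (λ p q W → (x + d) * φ p q W + d * ψ p q W)
      ≈⟨ rows-cong T ≋-refl ≋-refl (λ p q W → ≋-trans
           (solve 5 (λ y d A B k → y :* (A :* k) :+ d :* (B :* k) := (y :* A :+ d :* B) :* k) ≋-refl (x + d) d _ _ (G W))
           (≋-sym (≋-trans (braid-*ʳ x d p q _ (G W)) (*-cong (braid-δ x d c<e p q) ≋-refl)))) ⟩
    rows x (x + d) T (λ p q W → braid x d p q (λ p q → φ p q W))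
      ≈⟨ rows-braid x d T φ ⟩
    x * rows (x + d) x T φ
      ≈⟨ *-cong ≋-refl (≋-trans (grid-rows n (z ∘ swapFun zero) σ T)
           (rows-cong T (≋-sym x+d≋y) ≋-refl (λ p q W → ≋-refl))) ⟨
    x * grid (suc (suc n)) (z ∘ swapFun zero) σ T ∎
    where
    x = z zero
    y = z (suc zero)
    G : Vec S _ → Carrier
    G = grid n (λ k → z (suc (suc k))) (λ k → σ (suc (suc k)))
    φ ψ : S → S → Vec S _ → Carrier
    φ p q W = δ p (σ zero) * δ q (σ (suc zero)) * G W
    ψ p q W = δ p (σ (suc zero)) * δ q (σ zero) * G W
  -- The first row is the same in all three grids, so the relation for the rows below passes through
  -- it by linearity.
  grid-swap {n = suc n} (suc i) z σ T d c<e x+d≋y = begin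
    y * row (z zero) T (λ a V → δ a (σ zero) * g z σ V) +
    d * row (z zero) T (λ a V → δ a (σ zero) * grid (suc n) (z ∘ suc) (σ ∘ swapFun (suc i) ∘ suc) V)
      ≈⟨ +-cong (row-* _ T y _) (row-* _ T d _) ⟨
    row (z zero) T _ + row (z zero) T _
      ≈⟨ row-+ _ T _ _ ⟨
    row (z zero) T (λ a V → y * (δ a (σ zero) * g z σ V) +
      d * (δ a (σ zero) * grid (suc n) (z ∘ suc) (σ ∘ swapFun (suc i) ∘ suc) V))
      ≈⟨ row-cong T ≋-refl (λ a V → ≋-trans
           (+-cong ≋-refl (*-cong ≋-refl (*-cong ≋-refl
             (grid-cong (suc n) {z ∘ suc} {σ′ = λ k → σ (suc (swapFun i k))} V (λ _ → ≋-refl)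
               (λ k → cong σ (swapFun-suc-suc i k))))))
           (≋-trans (solve 5 (λ y d D A B → y :* (D :* A) :+ d :* (D :* B) := D :* (y :* A :+ d :* B))
               ≋-refl y d (δ a (σ zero)) _ _)
           (≋-trans (*-cong ≋-refl (≋-trans (grid-swap i (z ∘ suc) (σ ∘ suc) V d c<e x+d≋y)
             (*-cong ≋-refl (grid-cong (suc n) {λ k → z (suc (swapFun i k))} {σ = σ ∘ suc} V
               (λ k → ≋-reflexive (cong z (≡.sym (swapFun-suc-suc i k)))) (λ _ → refl)))))
           (solve 3 (λ x D A → D :* (x :* A) := x :* (D :* A)) ≋-refl x (δ a (σ zero)) _)))) ⟩
    row (z zero) T (λ a V → x * (δ a (σ zero) * g (z ∘ swapFun (suc i)) σ V))
      ≈⟨ row-* _ T x _ ⟩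
    x * grid (suc (suc n)) (z ∘ swapFun (suc i)) σ T ∎
    where
    x = z (inject₁ (suc i))
    y = z (suc (suc i))
    g : (Fin (suc (suc n)) → Carrier) → (Fin (suc (suc n)) → Fin r) → Vec S _ → Carrier
    g z σ V = grid (suc n) (z ∘ suc) (σ ∘ suc) V

  -- The single state for the identity permutation

  open import Algebra.Properties.Semiring.Exp semiring using (_^_)

  Π : ∀ m → (Fin m → Carrier) → Carrier
  Π zero    f = 1#
  Π (suc m) f = f zero * Π m (f ∘ suc)

  row-vacant : ∀ x C φ → row x (replicate C nothing) φ ≋ φ nothing (replicate C nothing)
  row-vacant x zero    φ = ≋-refl
  row-vacant x (suc C) φ = row-vacant x C _

  -- The leftmost color of T is c, in column p and larger than all others; T′ is T without it.
  data Peel (c : Fin r) : ℕ → Vec S C → Vec S C → Set where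
    here : Peel c 0 (just c ∷ replicate C nothing) (nothing ∷ replicate C nothing)
    skip : ∀ {p} {T T′ : Vec S C} → Peel c p T T′ → Peel c (suc p) (nothing ∷ T) (nothing ∷ T′)
    pass : ∀ {p d} {T T′ : Vec S C} → c Fin.< d → Peel c p T T′ → Peel c (suc p) (just d ∷ T) (just d ∷ T′)

  -- With + above, a right exit `c` forces `c` on the left: the branch that turns down leaves + on
  -- the right and fails the test.
  vertex-skip : ∀ x l c (f : S → Carrier) → vertex x l nothing (λ a b → δ a c * f b) ≋ δ l c * (x * f nothing)
  vertex-skip x nothing  c f = ≋-trans (zeroˡ _) (≋-sym (zeroˡ _))
  vertex-skip x (just e) c f = solve 4 (λ x D A B → x :* (D :* A :+ con 0 :* B) := D :* (x :* A))
    ≋-refl x (δ (just e) c) (f nothing) (f (just e))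

  -- The right exit is either `d` or the larger of `d` and the left color. As `d` is smaller than
  -- `c`, exit `c` forces `c` on the left, and `d` goes straight down.
  vertex-pass : ∀ x l {c d} (f : S → Carrier) → c Fin.< d →
    vertex x l (just d) (λ a b → δ a c * f b) ≋ δ l c * (x * f (just d))
  vertex-pass x nothing {c} {d} f c<d = ≋-trans
    (*-cong (≋-reflexive (δ-≢ {d} {c} (λ { refl → ℕ.<-irrefl refl c<d }))) ≋-refl)
    (≋-trans (zeroˡ _) (≋-sym (zeroˡ _)))
  vertex-pass x (just e) {c} {d} f c<d = by-cases (e Fin.≟ c)
    where
    by-cases : Dec (e ≡ c) → x * (δ (just (cmax e d)) c * f (just (cmin e d))) ≋ δ (just e) c * (x * f (just d))
    by-cases (yes refl) rewrite cmax-≤ {c = e} {d} (ℕ.<⇒≤ c<d) | cmin-≤ {c = e} {d} (ℕ.<⇒≤ c<d) =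
      solve 3 (λ x D A → x :* (D :* A) := D :* (x :* A)) ≋-refl x (δ (just e) e) _
    by-cases (no e≢c) = begin
      x * (δ (just (cmax e d)) c * f (just (cmin e d)))
        ≈⟨ *-cong ≋-refl (≋-trans (*-cong (≋-reflexive (δ-≢ (larger (ℕ.≤-total (toℕ e) (toℕ d))))) ≋-refl) (zeroˡ _)) ⟩
      x * 0#                         ≈⟨ zeroʳ x ⟩
      0#                             ≈⟨ zeroˡ _ ⟨
      0# * (x * f (just d))          ≈⟨ *-cong (≋-reflexive (δ-≢ e≢c)) ≋-refl ⟨
      δ (just e) c * (x * f (just d)) ∎
      where
      larger : toℕ e ℕ.≤ toℕ d ⊎ toℕ d ℕ.≤ toℕ e → cmax e d ≢ c
      larger (inj₁ e≤d) eq = e≢c (≡.trans (≡.sym (cmax-≤ e≤d)) eq)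
      larger (inj₂ d≤e) eq = ℕ.<-irrefl
        (cong toℕ (≡.sym (≡.trans (≡.sym (cmax-≤ d≤e)) (≡.trans (cmax-comm d e) eq)))) c<d

  -- Read from right to left, exit `c` forces `c` on every horizontal edge back to column `p`, which
  -- it enters with weight 1. Each of the `p` columns to the right costs a factor `x`, absorbed into
  -- `ψ` on the way.
  row-peel : ∀ x {c p} {T T′ : Vec S C} ψ → Peel c p T T′ →
    row x T (λ a V → δ a c * ψ V) ≋ x ^ p * ψ T′
  row-peel x {c} ψ (here {C}) = begin
    row x (replicate C nothing) _              ≈⟨ row-vacant x C _ ⟩
    δ (just c) c * ψ (nothing ∷ replicate C nothing) ≈⟨ *-cong (≋-reflexive (ι-≟-refl (just c))) ≋-refl ⟩
    1# * ψ (nothing ∷ replicate C nothing)     ∎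
  row-peel x {c} {suc p} {T = _ ∷ T} {_ ∷ T′} ψ (skip h) = begin
    row x T (λ l V → vertex x l nothing (λ a b → δ a c * ψ (b ∷ V)))
      ≈⟨ row-cong T ≋-refl (λ l V → vertex-skip x l c (λ b → ψ (b ∷ V))) ⟩
    row x T (λ l V → δ l c * (x * ψ (nothing ∷ V)))   ≈⟨ row-peel x (λ V → x * ψ (nothing ∷ V)) h ⟩
    x ^ p * (x * ψ (nothing ∷ T′))
      ≈⟨ solve 3 (λ x P A → P :* (x :* A) := (x :* P) :* A) ≋-refl x (x ^ p) _ ⟩
    x * x ^ p * ψ (nothing ∷ T′) ∎
  row-peel x {c} {suc p} {T = just d ∷ T} {_ ∷ T′} ψ (pass c<d h) = begin
    row x T (λ l V → vertex x l (just d) (λ a b → δ a c * ψ (b ∷ V)))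
      ≈⟨ row-cong T ≋-refl (λ l V → vertex-pass x l (λ b → ψ (b ∷ V)) c<d) ⟩
    row x T (λ l V → δ l c * (x * ψ (just d ∷ V)))   ≈⟨ row-peel x (λ V → x * ψ (just d ∷ V)) h ⟩
    x ^ p * (x * ψ (just d ∷ T′))
      ≈⟨ solve 3 (λ x P A → P :* (x :* A) := (x :* P) :* A) ≋-refl x (x ^ p) _ ⟩
    x * x ^ p * ψ (just d ∷ T′) ∎

  tabulate-nothing : ∀ {f : Fin C → S} → (∀ j → f j ≡ nothing) → tabulate f ≡ replicate C nothing
  tabulate-nothing {zero}  h = refl
  tabulate-nothing {suc C} h = cong₂ _∷_ (h zero) (tabulate-nothing (h ∘ suc))

  peel-tabulate : ∀ C p {c} (f g : ℕ → S) → p ℕ.< C → f p ≡ just c →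
    (∀ j → p ℕ.< j → f j ≡ nothing) → (∀ j → p ℕ.≤ j → g j ≡ nothing) →
    (∀ j → j ℕ.< p → f j ≡ g j) → (∀ j d → g j ≡ just d → c Fin.< d) →
    Peel c p (tabulate {n = C} (f ∘ toℕ)) (tabulate (g ∘ toℕ))
  peel-tabulate (suc C) zero f g p<C fp f0 g0 fg gc
    rewrite fp | g0 0 z≤n
          | tabulate-nothing {C} {f ∘ suc ∘ toℕ} (λ j → f0 _ (s≤s z≤n))
          | tabulate-nothing {C} {g ∘ suc ∘ toℕ} (λ j → g0 _ z≤n) = here
  peel-tabulate (suc C) (suc p) f g (s≤s p<C) fp f0 g0 fg gc
    rewrite fg 0 (s≤s z≤n) with g 0 | gc 0
  ... | nothing | _  = skip (peel-tabulate C p (f ∘ suc) (g ∘ suc) p<C fp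
    (λ j lt → f0 (suc j) (s≤s lt)) (λ j le → g0 (suc j) (s≤s le)) (λ j lt → fg (suc j) (s≤s lt)) (gc ∘ suc))
  ... | just d  | c< = pass (c< d refl) (peel-tabulate C p (f ∘ suc) (g ∘ suc) p<C fp
    (λ j lt → f0 (suc j) (s≤s lt)) (λ j le → g0 (suc j) (s≤s le)) (λ j lt → fg (suc j) (s≤s lt)) (gc ∘ suc))

  -- The fold in `topSpin`, with colors and columns given as functions on `Fin m` so that an
  -- induction can drop the first color.
  place : ∀ m → (Fin m → Fin r) → (Fin m → ℕ) → ℕ → S
  place zero    σ pos j = nothing
  place (suc m) σ pos j = if does (j ℕ.≟ pos zero) then just (σ zero) else place m (σ ∘ suc) (pos ∘ suc) j

  place-≡ : ∀ m σ pos → place (suc m) σ pos (pos zero) ≡ just (σ zero)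
  place-≡ m σ pos rewrite dec-true (pos zero ℕ.≟ pos zero) refl = refl

  place-≢ : ∀ m σ pos {j} → j ≢ pos zero → place (suc m) σ pos j ≡ place m (σ ∘ suc) (pos ∘ suc) j
  place-≢ m σ pos {j} ne rewrite dec-false (j ℕ.≟ pos zero) ne = refl

  place-nothing : ∀ m σ pos {j} → (∀ k → pos k ℕ.< j) → place m σ pos j ≡ nothing
  place-nothing zero    σ pos h = refl
  place-nothing (suc m) σ pos h = ≡.trans
    (place-≢ m σ pos (λ { refl → ℕ.<-irrefl refl (h zero) })) (place-nothing m _ _ (h ∘ suc))

  place-just : ∀ m σ pos {j d} → place m σ pos j ≡ just d → ∃[ k ] σ k ≡ d
  place-just (suc m) σ pos {j} eq with does (j ℕ.≟ pos zero)
  ... | true  = zero , Maybe.just-injective eq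
  ... | false with k , e ← place-just m (σ ∘ suc) (pos ∘ suc) eq = suc k , e

  -- Each row removes one color and leaves the same problem for the others. The first color is the
  -- leftmost by `anti` and the largest by `mono`, which is what `Peel` requires.
  grid-increasing : ∀ m z σ pos → (∀ k → pos k ℕ.< C) →
    (∀ {i j} → i Fin.< j → pos j ℕ.< pos i) → (∀ {i j} → i Fin.< j → σ i Fin.< σ j) →
    grid m z σ (tabulate {n = C} (place m σ pos ∘ toℕ)) ≋ Π m (λ k → z k ^ pos k)
  grid-increasing {C} zero z σ pos bound anti mono = ≋-reflexive (cong ι (all-vacant C))
    where
    all-vacant : ∀ C → vacant (tabulate {n = C} (λ _ → nothing)) ≡ true
    all-vacant zero    = refl
    all-vacant (suc C) = all-vacant C
  grid-increasing {C} (suc m) z σ pos bound anti mono = ≋-trans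
    (row-peel (z zero) (grid m (z ∘ suc) (σ ∘ suc))
      (peel-tabulate C (pos zero) (place (suc m) σ pos) (place m (σ ∘ suc) (pos ∘ suc))
        (bound zero) (place-≡ m σ pos)
        (λ j lt → ≡.trans (place-≢ m σ pos (λ { refl → ℕ.<-irrefl refl lt })) (rest j (ℕ.<⇒≤ lt)))
        rest
        (λ j lt → place-≢ m σ pos (λ { refl → ℕ.<-irrefl refl lt }))
        (λ j d eq → let k , e = place-just m (σ ∘ suc) (pos ∘ suc) eq in ≡.subst (σ zero Fin.<_) e (mono (s≤s z≤n)))))
    (*-cong ≋-refl (grid-increasing m (z ∘ suc) (σ ∘ suc) (pos ∘ suc) (bound ∘ suc) (anti ∘ s≤s) (mono ∘ s≤s)))
    where
    rest : ∀ j → pos zero ℕ.≤ j → place m (σ ∘ suc) (pos ∘ suc) j ≡ nothing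
    rest j le = place-nothing m _ _ (λ k → ℕ.<-≤-trans (anti (s≤s z≤n)) le)

  module Hom (θ : Carrier → Carrier) (θ-cong : ∀ {x y} → x ≋ y → θ x ≋ θ y)
    (θ-+ : ∀ x y → θ (x + y) ≋ θ x + θ y) (θ-* : ∀ x y → θ (x * y) ≋ θ x * θ y)
    (θ-0 : θ 0# ≋ 0#) (θ-1 : θ 1# ≋ 1#) where

    hom-ι : ∀ b → θ (ι b) ≋ ι b
    hom-ι true  = θ-1
    hom-ι false = θ-0

    hom-vertex : ∀ x l t φ → θ (vertex x l t φ) ≋ vertex (θ x) l t (λ a b → θ (φ a b))
    hom-vertex x nothing  nothing  φ = ≋-refl
    hom-vertex x nothing  (just _) φ = ≋-refl
    hom-vertex x (just _) nothing  φ = ≋-trans (θ-* _ _) (*-cong ≋-refl (θ-+ _ _))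
    hom-vertex x (just _) (just _) φ = θ-* _ _

    hom-row : ∀ x (T : Vec S C) φ → θ (row x T φ) ≋ row (θ x) T (λ a V → θ (φ a V))
    hom-row x []      φ = ≋-refl
    hom-row x (t ∷ T) φ = ≋-trans (hom-row x T _) (row-cong T ≋-refl (λ l V → hom-vertex x l t _))

    -- `grid` is built from its parameters by sums and products, so an endomorphism acts on the
    -- parameters only. For s_i this identifies the image of a partition function with the grid
    -- whose row parameters are exchanged.
    hom-grid : ∀ m z σ (T : Vec S C) → θ (grid m z σ T) ≋ grid m (θ ∘ z) σ T
    hom-grid zero    z σ T = hom-ι (vacant T)
    hom-grid (suc m) z σ T = ≋-trans (hom-row (z zero) T _) (row-cong T ≋-refl (λ a V →
      ≋-trans (θ-* _ _) (*-cong (hom-ι _) (hom-grid m (z ∘ suc) (σ ∘ suc) V))))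

-- Sums over states

module Sums {c ℓ} (R : CommutativeRing c ℓ) (r : ℕ) where
  open Lattice R r
  open CommutativeRing R using (Carrier; _+_; _*_; 0#; 1#; setoid; commutativeSemiring; +-cong; *-cong;
    +-identityʳ; +-identityˡ; *-identityʳ; *-identityˡ; zeroˡ; zeroʳ; distribˡ; *-assoc; +-assoc)
    renaming (_≈_ to _≋_; refl to ≋-refl; sym to ≋-sym; trans to ≋-trans; reflexive to ≋-reflexive)
  open import Relation.Binary.Reasoning.Setoid setoid
  open Solver commutativeSemiring using (solve; _:=_; _:+_; _:*_; con)

  private
    S : Set
    S = Spin r
    variable
      A B : Set

  ∑ : List A → (A → Carrier) → Carrier
  ∑ xs f = foldr (λ x acc → f x + acc) 0# xs

  ∑-cong : (xs : List A) {f g : A → Carrier} → (∀ x → f x ≋ g x) → ∑ xs f ≋ ∑ xs g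
  ∑-cong []       h = ≋-refl
  ∑-cong (x ∷ xs) h = +-cong (h x) (∑-cong xs h)

  ∑-++ : (xs ys : List A) (f : A → Carrier) → ∑ (xs ++ ys) f ≋ ∑ xs f + ∑ ys f
  ∑-++ []       ys f = ≋-sym (+-identityˡ _)
  ∑-++ (x ∷ xs) ys f = ≋-trans (+-cong ≋-refl (∑-++ xs ys f)) (≋-sym (+-assoc _ _ _))

  ∑-map : (h : A → B) (xs : List A) (f : B → Carrier) → ∑ (List.map h xs) f ≋ ∑ xs (f ∘ h)
  ∑-map h []       f = ≋-refl
  ∑-map h (x ∷ xs) f = +-cong ≋-refl (∑-map h xs f)

  ∑-concatMap : (h : A → List B) (xs : List A) (f : B → Carrier) →
    ∑ (concatMap h xs) f ≋ ∑ xs (λ x → ∑ (h x) f)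
  ∑-concatMap h []       f = ≋-refl
  ∑-concatMap h (x ∷ xs) f = ≋-trans (∑-++ (h x) _ f) (+-cong ≋-refl (∑-concatMap h xs f))

  ∑-zero : (xs : List A) {f : A → Carrier} → (∀ x → f x ≋ 0#) → ∑ xs f ≋ 0#
  ∑-zero []       h = ≋-refl
  ∑-zero (x ∷ xs) h = ≋-trans (+-cong (h x) (∑-zero xs h)) (+-identityˡ _)

  ∑-+ : (xs : List A) (f g : A → Carrier) → ∑ xs (λ x → f x + g x) ≋ ∑ xs f + ∑ xs g
  ∑-+ []       f g = ≋-sym (+-identityˡ _)
  ∑-+ (x ∷ xs) f g = ≋-trans (+-cong ≋-refl (∑-+ xs f g))
    (solve 4 (λ a b s t → (a :+ b) :+ (s :+ t) := (a :+ s) :+ (b :+ t)) ≋-refl (f x) (g x) _ _)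

  ∑-*ˡ : (xs : List A) (k : Carrier) (f : A → Carrier) → ∑ xs (λ x → k * f x) ≋ k * ∑ xs f
  ∑-*ˡ []       k f = ≋-sym (zeroʳ k)
  ∑-*ˡ (x ∷ xs) k f = ≋-trans (+-cong ≋-refl (∑-*ˡ xs k f)) (≋-sym (distribˡ k _ _))

  ∑-comm : (xs : List A) (ys : List B) (f : A → B → Carrier) →
    ∑ xs (λ x → ∑ ys (f x)) ≋ ∑ ys (λ y → ∑ xs (λ x → f x y))
  ∑-comm []       ys f = ≋-sym (∑-zero ys (λ _ → ≋-refl))
  ∑-comm (x ∷ xs) ys f = ≋-trans (+-cong ≋-refl (∑-comm xs ys f)) (≋-sym (∑-+ ys _ _))

  ∑-tabulate-single : ∀ {n} (h : Fin n → A) (f : A → Carrier) i → (∀ j → j ≢ i → f (h j) ≋ 0#) →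
    ∑ (List.tabulate h) f ≋ f (h i)
  ∑-tabulate-single h f zero v = ≋-trans (+-cong ≋-refl (vanish (h ∘ suc) (λ j → v (suc j) (λ ())))) (+-identityʳ _)
    where
    vanish : ∀ {n} (h : Fin n → _) → (∀ j → f (h j) ≋ 0#) → ∑ (List.tabulate h) f ≋ 0#
    vanish {zero}  h v = ≋-refl
    vanish {suc n} h v = ≋-trans (+-cong (v zero) (vanish (h ∘ suc) (v ∘ suc))) (+-identityˡ _)
  ∑-tabulate-single h f (suc i) v = ≋-trans
    (+-cong (v zero (λ ())) (∑-tabulate-single (h ∘ suc) f i (λ j ne → v (suc j) (ne ∘ Fin.suc-injective))))
    (+-identityˡ _)

  spins : List S
  spins = allSpins r

  ∑-colors : (f : S → Carrier) (c : Fin r) → (∀ d → d ≢ c → f (just d) ≋ 0#) →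
    ∑ (List.map just (allFin r)) f ≋ f (just c)
  ∑-colors f c v = ≋-trans (∑-map just (allFin r) f) (∑-tabulate-single id (f ∘ just) c v)

  ∑-spins : (f : S → Carrier) (s : S) → (∀ t → t ≢ s → f t ≋ 0#) → ∑ spins f ≋ f s
  ∑-spins f nothing  v = ≋-trans (+-cong ≋-refl (≋-trans (∑-map just (allFin r) f)
    (∑-zero (allFin r) (λ d → v (just d) (λ ()))))) (+-identityʳ _)
  ∑-spins f (just c) v = ≋-trans (+-cong (v nothing (λ ()))
    (∑-colors f c (λ d ne → v (just d) (ne ∘ Maybe.just-injective)))) (+-identityˡ _)

  ev : Carrier → VW → Carrier
  ev x w0 = 0#
  ev x w1 = 1#
  ev x wz = x

  -- For given left and top spins the weight is supported on one output, or on two for a color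
  -- meeting +; these are the clauses of `vertex`.
  ∑-vertex : ∀ x l t φ →
    ∑ spins (λ a → ∑ spins (λ b → ev x (vw l t a b) * φ a b)) ≋ vertex x l t φ
  ∑-vertex x nothing nothing φ = ≋-trans
    (∑-spins _ nothing λ
      { nothing  ne → ⊥-elim (ne refl)
      ; (just _) _  → ∑-zero spins (λ { nothing → zeroˡ _ ; (just _) → zeroˡ _ }) })
    (≋-trans (∑-spins _ nothing λ { nothing ne → ⊥-elim (ne refl) ; (just _) _ → zeroˡ _ })
      (*-identityˡ _))
  ∑-vertex x nothing (just d) φ = ≋-trans
    (∑-spins _ (just d) λ
      { nothing  _  → ∑-zero spins (λ { nothing → zeroˡ _ ; (just _) → zeroˡ _ })
      ; (just e) ne → ∑-zero spins (λ { nothing → off e ne ; (just _) → zeroˡ _ }) })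
    (≋-trans (∑-spins _ nothing λ { nothing ne → ⊥-elim (ne refl) ; (just _) _ → zeroˡ _ })
      (≋-trans (*-cong (≋-reflexive (cong (λ b → ev x (if b then w1 else w0)) (dec-true (d Fin.≟ d) refl))) ≋-refl)
        (*-identityˡ _)))
    where
    off : ∀ e → just e ≢ just d → ev x (vw nothing (just d) (just e) nothing) * φ (just e) nothing ≋ 0#
    off e ne rewrite dec-false (d Fin.≟ e) (λ d≡e → ne (cong just (≡.sym d≡e))) = zeroˡ _
  ∑-vertex x (just c) nothing φ = begin
    ∑ spins (λ b → ev x (vw (just c) nothing nothing b) * φ nothing b) +
    ∑ (List.map just (allFin r)) (λ a → ∑ spins (λ b → ev x (vw (just c) nothing a b) * φ a b))
      ≈⟨ +-cong
          (∑-spins _ (just c) (λ { nothing _ → zeroˡ _ ; (just e) ne → *-zero (off e ne) }))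
          (≋-trans (∑-colors _ c (λ e ne → ∑-zero spins (λ
             { nothing → *-zero (off e (ne ∘ Maybe.just-injective)) ; (just _) → zeroˡ _ })))
           (∑-spins _ nothing (λ { nothing ne → ⊥-elim (ne refl) ; (just _) _ → zeroˡ _ }))) ⟩
    ev x (if does (c Fin.≟ c) then wz else w0) * φ nothing (just c) +
    ev x (if does (c Fin.≟ c) then wz else w0) * φ (just c) nothing
      ≡⟨ cong (λ b → ev x (if b then wz else w0) * φ nothing (just c) + ev x (if b then wz else w0) * φ (just c) nothing)
           (dec-true (c Fin.≟ c) refl) ⟩
    x * φ nothing (just c) + x * φ (just c) nothing
      ≈⟨ solve 3 (λ x A B → x :* A :+ x :* B := x :* (B :+ A)) ≋-refl x _ _ ⟩
    x * (φ (just c) nothing + φ nothing (just c)) ∎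
    where
    *-zero : ∀ {k a} → k ≡ 0# → k * a ≋ 0#
    *-zero refl = zeroˡ _
    off : ∀ e → just e ≢ just c → ev x (if does (c Fin.≟ e) then wz else w0) ≡ 0#
    off e ne rewrite dec-false (c Fin.≟ e) (λ d≡e → ne (cong just (≡.sym d≡e))) = refl
  ∑-vertex x (just c) (just d) φ = ≋-trans
    (∑-spins _ (just (cmax c d)) (λ a ne → ∑-zero spins (λ b → *-zero (offₐ a b ne))))
    (≋-trans (∑-spins _ (just (cmin c d)) (λ b ne → *-zero (off_b b ne)))
      (*-cong (≋-reflexive on) ≋-refl))
    where
    *-zero : ∀ {k a} → k ≡ 0# → k * a ≋ 0#
    *-zero refl = zeroˡ _
    offₐ : ∀ a b → a ≢ just (cmax c d) → ev x (vw (just c) (just d) a b) ≡ 0#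
    offₐ a b ne rewrite dec-false (a ≟S just (cmax c d)) ne = refl
    off_b : ∀ b → b ≢ just (cmin c d) → ev x (vw (just c) (just d) (just (cmax c d)) b) ≡ 0#
    off_b b ne rewrite dec-false (b ≟S just (cmin c d)) ne
      with does (cmax c d Fin.≟ cmax c d)
    ... | true  = refl
    ... | false = refl
    on : ev x (vw (just c) (just d) (just (cmax c d)) (just (cmin c d))) ≡ x
    on rewrite dec-true (cmax c d Fin.≟ cmax c d) refl | dec-true (cmin c d Fin.≟ cmin c d) refl = refl

  -- `allFuns` extends functions by an anonymous pattern-matching lambda; `Fun._∷_` is a named
  -- operation with the same values, about which lemmas can be stated.
  funs : ∀ m → List A → List (Fin m → A)
  funs zero    xs = (λ ()) ∷ []
  funs (suc m) xs = concatMap (λ x → List.map (x Fun.∷_) (funs m xs)) xs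

  -- The two enumerations agree only pointwise, so a summand must respect pointwise equality before
  -- its sum can be transferred.
  Ext : ∀ {m} → ((Fin m → A) → Carrier) → Set _
  Ext f = ∀ {g h} → (∀ i → g i ≡ h i) → f g ≋ f h

  ∑-funs-suc : ∀ m (xs : List A) (f : (Fin (suc m) → A) → Carrier) →
    ∑ (funs (suc m) xs) f ≋ ∑ xs (λ x → ∑ (funs m xs) (λ g → f (x Fun.∷ g)))
  ∑-funs-suc m xs f = ≋-trans (∑-concatMap _ xs f) (∑-cong xs (λ x → ∑-map _ (funs m xs) f))

  ∑-allFuns : ∀ m (xs : List A) (f : (Fin m → A) → Carrier) → Ext f →
    ∑ (allFuns m xs) f ≋ ∑ (funs m xs) f
  ∑-allFuns zero    xs f ext = +-cong (ext (λ ())) ≋-refl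
  ∑-allFuns (suc m) xs f ext = begin
    ∑ (allFuns (suc m) xs) f
      ≈⟨ ≋-trans (∑-concatMap _ xs f) (∑-cong xs (λ x → ∑-map _ (allFuns m xs) f)) ⟩
    ∑ xs (λ x → ∑ (allFuns m xs) (λ g → f _))
      ≈⟨ ∑-cong xs (λ x → ∑-cong (allFuns m xs) (λ g → ext (λ { zero → refl ; (suc i) → refl }))) ⟩
    ∑ xs (λ x → ∑ (allFuns m xs) (λ g → f (x Fun.∷ g)))
      ≈⟨ ∑-cong xs (λ x → ∑-allFuns m xs (λ g → f (x Fun.∷ g))
           (λ e → ext (λ { zero → refl ; (suc i) → e i }))) ⟩
    ∑ xs (λ x → ∑ (funs m xs) (λ g → f (x Fun.∷ g)))
      ≈⟨ ∑-funs-suc m xs f ⟨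
    ∑ (funs (suc m) xs) f ∎

  Π-cong : ∀ m {f g : Fin m → Carrier} → (∀ i → f i ≋ g i) → Π m f ≋ Π m g
  Π-cong zero    h = ≋-refl
  Π-cong (suc m) h = *-cong (h zero) (Π-cong m (h ∘ suc))

  Π-* : ∀ m (f g : Fin m → Carrier) → Π m (λ i → f i * g i) ≋ Π m f * Π m g
  Π-* zero    f g = ≋-sym (*-identityˡ _)
  Π-* (suc m) f g = ≋-trans (*-cong ≋-refl (Π-* m (f ∘ suc) (g ∘ suc)))
    (solve 4 (λ a b s t → (a :* b) :* (s :* t) := (a :* s) :* (b :* t)) ≋-refl (f zero) (g zero) _ _)

  ι-∧ : ∀ a b → ι (a ∧ b) ≋ ι a * ι b
  ι-∧ true  b = ≋-sym (*-identityˡ _)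
  ι-∧ false b = ≋-sym (zeroˡ _)

  ι-allB : ∀ {m} (h : Fin m → A) (p : A → Bool) → ι (allB p (List.tabulate h)) ≋ Π m (ι ∘ p ∘ h)
  ι-allB {m = zero}  h p = ≋-refl
  ι-allB {m = suc m} h p = ≋-trans (ι-∧ (p (h zero)) _) (*-cong ≋-refl (ι-allB (h ∘ suc) p))

  product : List Carrier → Carrier
  product = foldr _*_ 1#

  product-++ : ∀ xs ys → product (xs ++ ys) ≋ product xs * product ys
  product-++ []       ys = ≋-sym (*-identityˡ _)
  product-++ (x ∷ xs) ys = ≋-trans (*-cong ≋-refl (product-++ xs ys)) (≋-sym (*-assoc _ _ _))

  product-map : ∀ {m} (h : Fin m → A) (f : A → Carrier) →
    product (List.map f (List.tabulate h)) ≋ Π m (f ∘ h)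
  product-map {m = zero}  h f = ≋-refl
  product-map {m = suc m} h f = *-cong ≋-refl (product-map (h ∘ suc) f)

  product-concatMap : ∀ {m} (h : Fin m → A) (f : A → List Carrier) →
    product (concatMap f (List.tabulate h)) ≋ Π m (product ∘ f ∘ h)
  product-concatMap {m = zero}  h f = ≋-refl
  product-concatMap {m = suc m} h f = ≋-trans (product-++ (f (h zero)) _)
    (*-cong ≋-refl (product-concatMap (h ∘ suc) f))

  -- The top boundary condition acts as a delta function, one column at a time.
  ∑-ι-pointwise : ∀ m (T : Fin m → S) f → Ext f →
    ∑ (funs m spins) (λ V → Π m (λ j → ι (does (V j ≟S T j))) * f V) ≋ f T
  ∑-ι-pointwise zero    T f ext = ≋-trans (+-identityʳ _) (≋-trans (*-identityˡ _) (ext (λ ())))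
  ∑-ι-pointwise (suc m) T f ext = begin
    ∑ (funs (suc m) spins) (λ V → Π (suc m) (λ j → ι (does (V j ≟S T j))) * f V)
      ≈⟨ ∑-funs-suc m spins _ ⟩
    ∑ spins (λ s → ∑ (funs m spins) (λ V → ι (does (s ≟S T zero)) * rest V * f (s Fun.∷ V)))
      ≈⟨ ∑-cong spins (λ s → ≋-trans (∑-cong (funs m spins) (λ V → *-assoc _ _ _)) (∑-*ˡ (funs m spins) _ _)) ⟩
    ∑ spins (λ s → ι (does (s ≟S T zero)) * ∑ (funs m spins) (λ V → rest V * f (s Fun.∷ V)))
      ≈⟨ ∑-spins _ (T zero) (λ s ne → ≋-trans (*-cong (≋-reflexive (ι-≟-≢ ne)) ≋-refl) (zeroˡ _)) ⟩
    ι (does (T zero ≟S T zero)) * ∑ (funs m spins) (λ V → rest V * f (T zero Fun.∷ V))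
      ≈⟨ ≋-trans (*-cong (≋-reflexive (ι-≟-refl (T zero))) ≋-refl) (*-identityˡ _) ⟩
    ∑ (funs m spins) (λ V → rest V * f (T zero Fun.∷ V))
      ≈⟨ ∑-ι-pointwise m (T ∘ suc) (λ V → f (T zero Fun.∷ V)) (λ e → ext (λ { zero → refl ; (suc i) → e i })) ⟩
    f (T zero Fun.∷ (T ∘ suc))
      ≈⟨ ext (λ { zero → refl ; (suc i) → refl }) ⟩
    f T ∎
    where
    rest : (Fin m → S) → Carrier
    rest V = Π m (λ j → ι (does (V j ≟S T (suc j))))

  rowWeight : ∀ {C} → Carrier → (Fin (suc C) → S) → (Fin C → S) → (Fin C → S) → Carrier
  rowWeight {C} x h T V = Π C (λ j → ev x (vw (h (suc j)) (T j) (h (inject₁ j)) (V j)))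

  -- The right and bottom edges of the rightmost column are moved innermost. By `∑-vertex` summing
  -- them turns `φ` into a functional `ψ` of the remaining columns, which is the recursion of `row`.
  ∑-row : ∀ {C} x (T : Fin C → S) (φ : S → Vec S C → Carrier) →
    ∑ (funs C spins) (λ V → ∑ (funs (suc C) spins) (λ h →
      ι (does (h (fromℕ C) ≟S nothing)) * φ (h zero) (tabulate V) * rowWeight x h T V)) ≋
    row x (tabulate T) φ
  ∑-row {zero} x T φ = begin
    ∑ (funs 1 spins) (λ h → ι (does (h zero ≟S nothing)) * φ (h zero) [] * 1#) + 0#
      ≈⟨ +-identityʳ _ ⟩
    ∑ (funs 1 spins) (λ h → ι (does (h zero ≟S nothing)) * φ (h zero) [] * 1#)
      ≈⟨ ∑-funs-suc 0 spins _ ⟩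
    ∑ spins (λ s → ι (does (s ≟S nothing)) * φ s [] * 1# + 0#)
      ≈⟨ ∑-spins _ nothing (λ s ne → ≋-trans (+-identityʳ _) (≋-trans (*-identityʳ _)
           (≋-trans (*-cong (≋-reflexive (ι-≟-≢ ne)) ≋-refl) (zeroˡ _)))) ⟩
    1# * φ nothing [] * 1# + 0#
      ≈⟨ solve 1 (λ a → con 1 :* a :* con 1 :+ con 0 := a) ≋-refl _ ⟩
    φ nothing [] ∎
  ∑-row {suc C} x T φ = begin
    ∑ (funs (suc C) spins) (λ V → ∑ (funs (suc (suc C)) spins) (λ h →
      ι (does (h (fromℕ (suc C)) ≟S nothing)) * φ (h zero) (tabulate V) * rowWeight x h T V))
      ≈⟨ ≋-trans (∑-funs-suc C spins _) (∑-cong spins (λ b → ∑-cong Vs (λ V → ∑-funs-suc (suc C) spins _))) ⟩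
    ∑ spins (λ b → ∑ Vs (λ V → ∑ spins (λ a → ∑ Hs (λ h → F a b V h))))
      ≈⟨ ≋-trans (∑-comm spins Vs _) (∑-cong Vs (λ V →
           ≋-trans (∑-cong spins (λ b → ∑-comm spins Hs _))
             (≋-trans (∑-comm spins Hs _) (∑-cong Hs (λ h → ∑-comm spins spins _))))) ⟩
    ∑ Vs (λ V → ∑ Hs (λ h → ∑ spins (λ a → ∑ spins (λ b → F a b V h))))
      ≈⟨ ∑-cong Vs (λ V → ∑-cong Hs (λ h → inner V h)) ⟩
    ∑ Vs (λ V → ∑ Hs (λ h → ι (does (h (fromℕ C) ≟S nothing)) * ψ (h zero) (tabulate V) * rowWeight x h (T ∘ suc) V))
      ≈⟨ ∑-row x (T ∘ suc) ψ ⟩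
    row x (tabulate (T ∘ suc)) ψ ∎
    where
    Vs = funs C spins
    Hs = funs (suc C) spins
    F : S → S → (Fin C → S) → (Fin (suc C) → S) → Carrier
    F a b V h = ι (does (h (fromℕ C) ≟S nothing)) * φ a (b ∷ tabulate V) *
      (ev x (vw (h zero) (T zero) a b) * rowWeight x h (T ∘ suc) V)
    ψ : S → Vec S C → Carrier
    ψ l V = vertex x l (T zero) (λ a b → φ a (b ∷ V))
    inner : ∀ V h → ∑ spins (λ a → ∑ spins (λ b → F a b V h)) ≋
      ι (does (h (fromℕ C) ≟S nothing)) * ψ (h zero) (tabulate V) * rowWeight x h (T ∘ suc) V
    inner V h = begin
      ∑ spins (λ a → ∑ spins (λ b → F a b V h))
        ≈⟨ ∑-cong spins (λ a → ∑-cong spins (λ b →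
             solve 4 (λ i f e w → (i :* f) :* (e :* w) := (i :* w) :* (e :* f)) ≋-refl i (φ a (b ∷ tabulate V)) _ w)) ⟩
      ∑ spins (λ a → ∑ spins (λ b → i * w * (ev x (vw (h zero) (T zero) a b) * φ a (b ∷ tabulate V))))
        ≈⟨ ≋-trans (∑-cong spins (λ a → ∑-*ˡ spins _ _)) (∑-*ˡ spins _ _) ⟩
      i * w * ∑ spins (λ a → ∑ spins (λ b → ev x (vw (h zero) (T zero) a b) * φ a (b ∷ tabulate V)))
        ≈⟨ *-cong ≋-refl (∑-vertex x (h zero) (T zero) (λ a b → φ a (b ∷ tabulate V))) ⟩
      i * w * ψ (h zero) (tabulate V)
        ≈⟨ solve 3 (λ i f w → (i :* w) :* f := (i :* f) :* w) ≋-refl i _ w ⟩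
      i * ψ (h zero) (tabulate V) * w ∎
      where
      i = ι (does (h (fromℕ C) ≟S nothing))
      w = rowWeight x h (T ∘ suc) V

  rowZ : ∀ {C} → Carrier → Fin r → (Fin (suc C) → S) → (Fin C → S) → (Fin C → S) → Carrier
  rowZ {C} x s h T V =
    ι (does (h (fromℕ C) ≟S nothing)) * ι (does (h zero ≟S just s)) * rowWeight x h T V

  -- The top boundary test is left out: in the induction over rows the top spins are whatever the
  -- row above has sent down.
  gridWeight : ∀ {C} m → (Fin m → Carrier) → (Fin m → Fin r) → (Fin m → Fin (suc C) → S) →
    (Fin (suc m) → Fin C → S) → Carrier
  gridWeight {C} m z σ h v = Π C (λ j → ι (does (v (fromℕ m) j ≟S nothing))) *
    Π m (λ k → rowZ (z k) (σ k) (h k) (v (inject₁ k)) (v (suc k)))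

  ι-vacant : ∀ {C} (T : Fin C → S) → Π C (λ j → ι (does (T j ≟S nothing))) ≋ ι (vacant (tabulate T))
  ι-vacant {zero}  T = ≋-refl
  ι-vacant {suc C} T = ≋-trans (*-cong ≋-refl (ι-vacant (T ∘ suc))) (≋-sym (ι-∧ _ _))

  rowWeight-cong : ∀ {C} x {h h′ : Fin (suc C) → S} (T : Fin C → S) {V V′ : Fin C → S} →
    (∀ i → h i ≡ h′ i) → (∀ j → V j ≡ V′ j) → rowWeight x h T V ≋ rowWeight x h′ T V′
  rowWeight-cong {C} x {h} {h′} T {V} eh eV = Π-cong C (λ j → ≋-reflexive (cong (ev x)
    (≡.trans (cong₂ (λ a b → vw a (T j) b (V j)) (eh (suc j)) (eh (inject₁ j)))
             (cong (vw (h′ (suc j)) (T j) (h′ (inject₁ j))) (eV j)))))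

  -- The outer enumerations are `funs`, so the first row splits off. The inner ones stay `allFuns`
  -- and are exchanged only when the sum has been reduced to a single row.
  ∑-grid : ∀ {C} m z σ (T : Fin C → S) →
    ∑ (funs m (allFuns (suc C) spins)) (λ h → ∑ (funs m (allFuns C spins)) (λ v →
      gridWeight m z σ h (T Fun.∷ v))) ≋
    grid m z σ (tabulate T)
  ∑-grid zero    z σ T = begin
    Π _ (λ j → ι (does (T j ≟S nothing))) * 1# + 0# + 0#
      ≈⟨ solve 1 (λ a → a :* con 1 :+ con 0 :+ con 0 := a) ≋-refl _ ⟩
    Π _ (λ j → ι (does (T j ≟S nothing)))
      ≈⟨ ι-vacant T ⟩
    ι (vacant (tabulate T)) ∎
  ∑-grid {C} (suc m) z σ T = begin
    ∑ (funs (suc m) Hs) (λ h → ∑ (funs (suc m) Vs) (λ v → gridWeight (suc m) z σ h (T Fun.∷ v)))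
      ≈⟨ ≋-trans (∑-funs-suc m Hs _) (∑-cong Hs (λ h → ∑-cong (funs m Hs) (λ h′ → ∑-funs-suc m Vs _))) ⟩
    ∑ Hs (λ h → ∑ (funs m Hs) (λ h′ → ∑ Vs (λ V → ∑ (funs m Vs) (λ v →
      gridWeight (suc m) z σ (h Fun.∷ h′) (T Fun.∷ (V Fun.∷ v))))))
      ≈⟨ ∑-cong Hs (λ h → ≋-trans (∑-comm (funs m Hs) Vs _) (∑-cong Vs (λ V →
           ≋-trans (∑-cong (funs m Hs) (λ h′ → ≋-trans (∑-cong (funs m Vs) (λ v →
               solve 3 (λ i a b → i :* (a :* b) := a :* (i :* b)) ≋-refl _ (rowZ (z zero) (σ zero) h T V) _))
             (∑-*ˡ (funs m Vs) _ _)))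
             (≋-trans (∑-*ˡ (funs m Hs) _ _) (*-cong ≋-refl (∑-grid m (z ∘ suc) (σ ∘ suc) V)))))) ⟩
    ∑ Hs (λ h → ∑ Vs (λ V → rowZ (z zero) (σ zero) h T V * G (tabulate V)))
      ≈⟨ ∑-cong Hs (λ h → ∑-allFuns C spins _ (λ e → *-cong
           (*-cong ≋-refl (rowWeight-cong (z zero) {h} T (λ _ → refl) e)) (≋-reflexive (cong G (Vec.tabulate-cong e))))) ⟩
    ∑ Hs (λ h → ∑ (funs C spins) (λ V → rowZ (z zero) (σ zero) h T V * G (tabulate V)))
      ≈⟨ ∑-allFuns (suc C) spins _ (λ e → ∑-cong (funs C spins) (λ V → *-cong
           (*-cong (≋-reflexive (cong₂ (λ a b → ι (does (a ≟S nothing)) * ι (does (b ≟S just (σ zero))))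
             (e (fromℕ C)) (e zero)))
             (rowWeight-cong (z zero) T e (λ _ → refl))) ≋-refl)) ⟩
    ∑ (funs (suc C) spins) (λ h → ∑ (funs C spins) (λ V → rowZ (z zero) (σ zero) h T V * G (tabulate V)))
      ≈⟨ ∑-comm (funs (suc C) spins) (funs C spins) _ ⟩
    ∑ (funs C spins) (λ V → ∑ (funs (suc C) spins) (λ h → rowZ (z zero) (σ zero) h T V * G (tabulate V)))
      ≈⟨ ∑-cong (funs C spins) (λ V → ∑-cong (funs (suc C) spins) (λ h →
           solve 4 (λ i j w g → i :* j :* w :* g := i :* (j :* g) :* w) ≋-refl _ _ _ _)) ⟩
    ∑ (funs C spins) (λ V → ∑ (funs (suc C) spins) (λ h → ι (does (h (fromℕ C) ≟S nothing)) *
      (ι (does (h zero ≟S just (σ zero))) * G (tabulate V)) * rowWeight (z zero) h T V))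
      ≈⟨ ∑-row (z zero) T (λ a V → ι (does (a ≟S just (σ zero))) * G V) ⟩
    grid (suc m) z σ (tabulate T) ∎
    where
    Hs = allFuns (suc C) spins
    Vs = allFuns C spins
    G : Vec S C → Carrier
    G = grid m (z ∘ suc) (σ ∘ suc)

  gridWeight-cong : ∀ {C} m z σ {h h′ : Fin m → Fin (suc C) → S} {v v′ : Fin (suc m) → Fin C → S} →
    (∀ k → h k ≡ h′ k) → (∀ k → v k ≡ v′ k) → gridWeight m z σ h v ≋ gridWeight m z σ h′ v′
  gridWeight-cong {C} m z σ {h′ = h′} {v} {v′} eh ev = *-cong
    (≋-reflexive (cong (λ V → Π C (λ j → ι (does (V j ≟S nothing)))) (ev (fromℕ m))))
    (Π-cong m (λ k → ≋-reflexive (≡.trans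
      (cong₂ (λ f T → rowZ (z k) (σ k) f T (v (suc k))) (eh k) (ev (inject₁ k)))
      (cong (rowZ (z k) (σ k) (h′ k) (v′ (inject₁ k))) (ev (suc k))))))

  ∑-grid-boundary : ∀ {C} m z σ (T : Fin C → S) →
    ∑ (allFuns m (allFuns (suc C) spins)) (λ h → ∑ (allFuns (suc m) (allFuns C spins)) (λ v →
      Π C (λ j → ι (does (v zero j ≟S T j))) * gridWeight m z σ h v)) ≋
    grid m z σ (tabulate T)
  ∑-grid-boundary {C} m z σ T = begin
    ∑ (allFuns m Hs) (λ h → ∑ (allFuns (suc m) Vs) (P h))
      ≈⟨ ∑-cong (allFuns m Hs) (λ h → ∑-allFuns (suc m) Vs (P h) (λ e → P-cong {h} {h} (λ _ → refl) e)) ⟩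
    ∑ (allFuns m Hs) (λ h → ∑ (funs (suc m) Vs) (P h))
      ≈⟨ ∑-allFuns m Hs _ (λ {h} {h′} e → ∑-cong (funs (suc m) Vs) (λ v → P-cong {h} {h′} {v} e (λ _ → refl))) ⟩
    ∑ (funs m Hs) (λ h → ∑ (funs (suc m) Vs) (P h))
      ≈⟨ ≋-trans (∑-cong (funs m Hs) (λ h → ∑-funs-suc m Vs _)) (∑-comm (funs m Hs) Vs _) ⟩
    ∑ Vs (λ V → ∑ (funs m Hs) (λ h → ∑ (funs m Vs) (λ v → top V * gridWeight m z σ h (V Fun.∷ v))))
      ≈⟨ ∑-cong Vs (λ V → ≋-trans (∑-cong (funs m Hs) (λ h → ∑-*ˡ (funs m Vs) (top V) _))
           (≋-trans (∑-*ˡ (funs m Hs) (top V) _) (*-cong ≋-refl (∑-grid m z σ V)))) ⟩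
    ∑ Vs (λ V → top V * grid m z σ (tabulate V))
      ≈⟨ ∑-allFuns C spins _ (λ e → *-cong (top-cong e) (grid-ext e)) ⟩
    ∑ (funs C spins) (λ V → top V * grid m z σ (tabulate V))
      ≈⟨ ∑-ι-pointwise C T _ grid-ext ⟩
    grid m z σ (tabulate T) ∎
    where
    Hs = allFuns (suc C) spins
    Vs = allFuns C spins
    top : (Fin C → S) → Carrier
    top V = Π C (λ j → ι (does (V j ≟S T j)))
    top-cong : ∀ {V V′ : Fin C → S} → (∀ j → V j ≡ V′ j) → top V ≋ top V′
    top-cong e = Π-cong C (λ j → ≋-reflexive (cong (λ s → ι (does (s ≟S T j))) (e j)))
    grid-ext : ∀ {V V′ : Fin C → S} → (∀ j → V j ≡ V′ j) →
      grid m z σ (tabulate V) ≋ grid m z σ (tabulate V′)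
    grid-ext e = ≋-reflexive (cong (grid m z σ) (Vec.tabulate-cong e))
    P : (Fin m → Fin (suc C) → S) → (Fin (suc m) → Fin C → S) → Carrier
    P h v = top (v zero) * gridWeight m z σ h v
    P-cong : ∀ {h h′ v v′} → (∀ k → h k ≡ h′ k) → (∀ k → v k ≡ v′ k) → P h v ≋ P h′ v′
    P-cong {h} {h′} {v} {v′} eh ev = *-cong (≋-reflexive (cong top (ev zero)))
      (gridWeight-cong m z σ {h} {h′} {v} {v′} eh ev)

  ∑-filter : (p : A → Bool) (f : A → Carrier) (xs : List A) →
    foldr _+_ 0# (List.map f (List.filterᵇ p xs)) ≋ ∑ xs (λ x → ι (p x) * f x)
  ∑-filter p f [] = ≋-refl
  ∑-filter p f (x ∷ xs) with p x
  ... | true  = +-cong (≋-sym (*-identityˡ _)) (∑-filter p f xs)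
  ... | false = ≋-trans (∑-filter p f xs) (≋-sym (≋-trans (+-cong (zeroˡ _) ≋-refl) (+-identityˡ _)))

  module _ (N : ℕ) (z : Fin r → Carrier) (σ : Fin r → Fin r) (T : Fin (suc N) → S)
    (wt : Fin r → VW → Carrier) (wt≋ev : ∀ k u → wt k u ≋ ev (z k) u) where

    -- This and `weight` repeat the shape of `System.boundaryOK` and `System.weight`, so that for
    -- Laurent polynomials the left side of `∑-states` is `Z` by computation.
    boundary : Assignment r N → Bool
    boundary a =
        allB (λ j → does (ver a zero j ≟S T j)) (allFin (suc N))
      ∧ allB (λ j → does (ver a (fromℕ r) j ≟S nothing)) (allFin (suc N))
      ∧ allB (λ k → does (hor a k (fromℕ (suc N)) ≟S nothing)) (allFin r)
      ∧ allB (λ k → does (hor a k zero ≟S just (σ k))) (allFin r)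

    weight : Assignment r N → Carrier
    weight a = product (concatMap (λ k → List.map (λ j →
        wt k (vw (hor a k (suc j)) (ver a (inject₁ k) j) (hor a k (inject₁ j)) (ver a (suc k) j)))
      (allFin (suc N))) (allFin r))

    ι-boundary*weight : ∀ h v → ι (boundary (mkA h v)) * weight (mkA h v) ≋
      Π (suc N) (λ j → ι (does (v zero j ≟S T j))) * gridWeight r z σ h v
    ι-boundary*weight h v = begin
      ι (boundary (mkA h v)) * weight (mkA h v)
        ≈⟨ *-cong ι-boundary weight-Π ⟩
      Π (suc N) (ι ∘ top) * (Π (suc N) (ι ∘ bottom) * (Π r (ι ∘ left) * Π r (ι ∘ right))) * Π r inside
        ≈⟨ solve 5 (λ t b l e i → t :* (b :* (l :* e)) :* i := t :* (b :* (l :* e :* i))) ≋-refl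
             (Π (suc N) (ι ∘ top)) (Π (suc N) (ι ∘ bottom)) (Π r (ι ∘ left)) (Π r (ι ∘ right)) (Π r inside) ⟩
      Π (suc N) (ι ∘ top) * (Π (suc N) (ι ∘ bottom) * (Π r (ι ∘ left) * Π r (ι ∘ right) * Π r inside))
        ≈⟨ *-cong ≋-refl (*-cong ≋-refl (≋-trans (Π-* r (λ k → ι (left k) * ι (right k)) inside)
             (*-cong (Π-* r (ι ∘ left) (ι ∘ right)) ≋-refl))) ⟨
      Π (suc N) (ι ∘ top) * gridWeight r z σ h v ∎
      where
      top bottom : Fin (suc N) → Bool
      top j = does (v zero j ≟S T j)
      bottom j = does (v (fromℕ r) j ≟S nothing)
      left right : Fin r → Bool
      left k = does (h k (fromℕ (suc N)) ≟S nothing)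
      right k = does (h k zero ≟S just (σ k))
      inside : Fin r → Carrier
      inside k = rowWeight (z k) (h k) (v (inject₁ k)) (v (suc k))
      spin : Fin r → Fin (suc N) → VW
      spin k j = vw (h k (suc j)) (v (inject₁ k) j) (h k (inject₁ j)) (v (suc k) j)
      all : ∀ {m} → (Fin m → Bool) → Bool
      all p = allB p (allFin _)
      ι-boundary : ι (boundary (mkA h v)) ≋
        Π (suc N) (ι ∘ top) * (Π (suc N) (ι ∘ bottom) * (Π r (ι ∘ left) * Π r (ι ∘ right)))
      ι-boundary = ≋-trans (ι-∧ (all top) (all bottom ∧ all left ∧ all right)) (*-cong (ι-allB id top)
        (≋-trans (ι-∧ (all bottom) (all left ∧ all right)) (*-cong (ι-allB id bottom)
          (≋-trans (ι-∧ (all left) (all right)) (*-cong (ι-allB id left) (ι-allB id right))))))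
      weight-Π : weight (mkA h v) ≋ Π r inside
      weight-Π = ≋-trans (product-concatMap id (λ k → List.map (wt k ∘ spin k) (allFin (suc N))))
        (Π-cong r (λ k → ≋-trans (product-map id (wt k ∘ spin k)) (Π-cong (suc N) (λ j → wt≋ev k (spin k j)))))

    ∑-states : foldr _+_ 0# (List.map weight (List.filterᵇ boundary (allAssignments r N))) ≋
      grid r z σ (tabulate T)
    ∑-states = begin
      foldr _+_ 0# (List.map weight (List.filterᵇ boundary (allAssignments r N)))
        ≈⟨ ∑-filter boundary weight (allAssignments r N) ⟩
      ∑ (allAssignments r N) (λ a → ι (boundary a) * weight a)
        ≈⟨ ≋-trans (∑-concatMap _ Hs _) (∑-cong Hs (λ h → ∑-map _ Vs _)) ⟩
      ∑ Hs (λ h → ∑ Vs (λ v → ι (boundary (mkA h v)) * weight (mkA h v)))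
        ≈⟨ ∑-cong Hs (λ h → ∑-cong Vs (λ v → ι-boundary*weight h v)) ⟩
      ∑ Hs (λ h → ∑ Vs (λ v → Π (suc N) (λ j → ι (does (v zero j ≟S T j))) * gridWeight r z σ h v))
        ≈⟨ ∑-grid-boundary r z σ T ⟩
      grid r z σ (tabulate T) ∎
      where
      Hs = allFuns r (allFuns (suc (suc N)) spins)
      Vs = allFuns (suc r) (allFuns (suc N) spins)

-- Specialisation to Laurent polynomials

open import Data.Integer using (+_)

lookup-injective : ∀ {n} {u v : Exponent n} → (∀ i → lookup u i ≡ lookup v i) → u ≡ v
lookup-injective {u = u} {v} h =
  trans (sym (Vec.tabulate∘lookup u)) (trans (Vec.tabulate-cong h) (Vec.tabulate∘lookup v))

permute : ∀ {n} → Fin n → Exponent (suc n) → Exponent (suc n)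
permute i μ = tabulate (λ x → lookup μ (swapFun i x))

lookup-permute : ∀ {n} (i : Fin n) μ x → lookup (permute i μ) x ≡ lookup μ (swapFun i x)
lookup-permute i μ x = Vec.lookup∘tabulate (λ x → lookup μ (swapFun i x)) x

permute-involutive : ∀ {n} (i : Fin n) μ → permute i (permute i μ) ≡ μ
permute-involutive i μ = lookup-injective (λ x → trans (lookup-permute i (permute i μ) x)
  (trans (lookup-permute i μ (swapFun i x)) (cong (lookup μ) (swapFun-involutive i x))))

permute-⊖ : ∀ {n} (i : Fin n) κ μ → permute i (κ ⊖ permute i μ) ≡ permute i κ ⊖ μ
permute-⊖ i κ μ = lookup-injective (λ x → begin
  lookup (permute i (κ ⊖ permute i μ)) x
    ≡⟨ lookup-permute i (κ ⊖ permute i μ) x ⟩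
  lookup (κ ⊖ permute i μ) (swapFun i x)
    ≡⟨ Vec.lookup-zipWith _ (swapFun i x) κ (permute i μ) ⟩
  lookup κ (swapFun i x) ℤ.- lookup (permute i μ) (swapFun i x)
    ≡⟨ cong₂ ℤ._-_ (sym (lookup-permute i κ x))
         (trans (sym (lookup-permute i (permute i μ) x)) (cong (λ ν → lookup ν x) (permute-involutive i μ))) ⟩
  lookup (permute i κ) x ℤ.- lookup μ x
    ≡⟨ Vec.lookup-zipWith _ x (permute i κ) μ ⟨
  lookup (permute i κ ⊖ μ) x ∎)
  where open ≡.≡-Reasoning

-- `permute i` is an involution, so it acts in the same way on exponents and on coefficient
-- functions. This is what makes `actS`, defined on lists, compatible with `≈`.
coeff-actS : ∀ {n} (i : Fin n) p κ → coeff (actS i p) κ ≡ coeff p (permute i κ)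
coeff-actS i [] κ = refl
coeff-actS i ((a , μ) ∷ p) κ = begin
  coeff ((a , permute i μ) ∷ actS i p) κ
    ≡⟨ coeff-∷ a (permute i μ) (actS i p) κ ⟩
  coeff₁ a (permute i μ) κ ℤ.+ coeff (actS i p) κ
    ≡⟨ cong₂ ℤ._+_ (cong (λ b → if b then a else 0ℤ) flip-≟) (coeff-actS i p κ) ⟩
  coeff₁ a μ (permute i κ) ℤ.+ coeff p (permute i κ)
    ≡⟨ coeff-∷ a μ p (permute i κ) ⟨
  coeff ((a , μ) ∷ p) (permute i κ) ∎
  where
  open ≡.≡-Reasoning
  flip-≟ : does (permute i μ ≟E κ) ≡ does (μ ≟E permute i κ)
  flip-≟ = does-⇔ (mk⇔ (λ e → trans (sym (permute-involutive i μ)) (cong (permute i) e))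
                       (λ e → trans (cong (permute i) e) (permute-involutive i κ)))
    (permute i μ ≟E κ) (μ ≟E permute i κ)

actS-cong : ∀ {n} (i : Fin n) {p q : LPoly (suc n)} → p ≈ q → actS i p ≈ actS i q
actS-cong i {p} {q} e κ = trans (coeff-actS i p κ) (trans (e _) (sym (coeff-actS i q κ)))

actS-+ : ∀ {n} (i : Fin n) (p q : LPoly (suc n)) → actS i (p +P q) ≈ actS i p +P actS i q
actS-+ i p q κ = cong (λ u → coeff u κ) (List.map-++ _ p q)

actS-* : ∀ {n} (i : Fin n) (p q : LPoly (suc n)) → actS i (p *P q) ≈ actS i p *P actS i q
actS-* i [] q κ = refl
actS-* i ((a , μ) ∷ p) q κ = begin
  coeff (actS i (((a , μ) ∷ p) *P q)) κ
    ≡⟨ coeff-actS i (((a , μ) ∷ p) *P q) κ ⟩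
  coeff (((a , μ) ∷ p) *P q) (permute i κ)
    ≡⟨ coeff-∷-* a μ p q (permute i κ) ⟩
  a ℤ.* coeff q (permute i κ ⊖ μ) ℤ.+ coeff (p *P q) (permute i κ)
    ≡⟨ cong₂ (λ ν c → a ℤ.* coeff q ν ℤ.+ c) (sym (permute-⊖ i κ μ))
         (trans (sym (coeff-actS i (p *P q) κ)) (actS-* i p q κ)) ⟩
  a ℤ.* coeff q (permute i (κ ⊖ permute i μ)) ℤ.+ coeff (actS i p *P actS i q) κ
    ≡⟨ cong (λ c → a ℤ.* c ℤ.+ coeff (actS i p *P actS i q) κ) (coeff-actS i q (κ ⊖ permute i μ)) ⟨
  a ℤ.* coeff (actS i q) (κ ⊖ permute i μ) ℤ.+ coeff (actS i p *P actS i q) κ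
    ≡⟨ coeff-∷-* a (permute i μ) (actS i p) (actS i q) κ ⟨
  coeff (actS i ((a , μ) ∷ p) *P actS i q) κ ∎
  where open ≡.≡-Reasoning

mono-cong : ∀ {r} {μ ν : Exponent r} → (∀ j → lookup μ j ≡ lookup ν j) → mono μ ≡ mono ν
mono-cong h = cong mono (lookup-injective h)

actS-1 : ∀ {n} (i : Fin n) → actS i 1P ≡ 1P
actS-1 i = mono-cong (λ j → trans (lookup-permute i (replicate _ 0ℤ) j)
  (trans (Vec.lookup-replicate (swapFun i j) 0ℤ) (sym (Vec.lookup-replicate j 0ℤ))))

unit : ∀ {r} → ℤ → Fin r → Exponent r
unit a k = tabulate (λ j → if does (j Fin.≟ k) then a else 0ℤ)

lookup-unit : ∀ {r} a (k j : Fin r) → lookup (unit a k) j ≡ (if does (j Fin.≟ k) then a else 0ℤ)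
lookup-unit a k j = Vec.lookup∘tabulate (λ j → if does (j Fin.≟ k) then a else 0ℤ) j

actS-var : ∀ {n} (i : Fin n) k → actS i (var k) ≡ var (swapFun i k)
actS-var i k = mono-cong (λ j → begin
  lookup (permute i (unit 1ℤ k)) j                         ≡⟨ lookup-permute i (unit 1ℤ k) j ⟩
  lookup (unit 1ℤ k) (swapFun i j)                         ≡⟨ lookup-unit 1ℤ k (swapFun i j) ⟩
  (if does (swapFun i j Fin.≟ k) then 1ℤ else 0ℤ)          ≡⟨ cong (λ b → if b then 1ℤ else 0ℤ) (flip-≟ j) ⟩
  (if does (j Fin.≟ swapFun i k) then 1ℤ else 0ℤ)          ≡⟨ lookup-unit 1ℤ (swapFun i k) j ⟨
  lookup (unit 1ℤ (swapFun i k)) j                         ∎)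
  where
  open ≡.≡-Reasoning
  flip-≟ : ∀ j → does (swapFun i j Fin.≟ k) ≡ does (j Fin.≟ swapFun i k)
  flip-≟ j = does-⇔ (mk⇔ (λ e → trans (sym (swapFun-involutive i j)) (cong (swapFun i) e))
                         (λ e → trans (cong (swapFun i) e) (swapFun-involutive i k)))
    (swapFun i j Fin.≟ k) (j Fin.≟ swapFun i k)

lookup-⊕ : ∀ {r} (μ ν : Exponent r) j → lookup (μ ⊕ ν) j ≡ lookup μ j ℤ.+ lookup ν j
lookup-⊕ μ ν j = Vec.lookup-zipWith _ j μ ν

lookup-0 : ∀ {r} (j : Fin r) → lookup (replicate r 0ℤ) j ≡ 0ℤ
lookup-0 j = Vec.lookup-replicate j 0ℤ

unit-⊕ : ∀ {r} a b (k j : Fin r) → lookup (unit a k ⊕ unit b k) j ≡ lookup (unit (a ℤ.+ b) k) j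
unit-⊕ a b k j rewrite lookup-⊕ (unit a k) (unit b k) j | lookup-unit a k j | lookup-unit b k j
  | lookup-unit (a ℤ.+ b) k j with does (j Fin.≟ k)
... | true  = refl
... | false = refl

unit-0 : ∀ {r} (k j : Fin r) → lookup (unit 0ℤ k) j ≡ lookup (replicate r 0ℤ) j
unit-0 k j rewrite lookup-unit 0ℤ k j | lookup-0 j with does (j Fin.≟ k)
... | true  = refl
... | false = refl

var-invVar : ∀ {r} (k : Fin r) → var k *P invVar k ≡ 1P
var-invVar k = mono-cong (λ j → trans (unit-⊕ 1ℤ (ℤ.- 1ℤ) k j) (unit-0 k j))

module _ {r : ℕ} where
  open import Algebra.Properties.Semiring.Exp (CommutativeRing.semiring (lPolyRing r)) using (_^_)
  open Lattice (lPolyRing r) r using (Π)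

  var-^ : ∀ (k : Fin r) p → var k ^ p ≡ mono (unit (+ p) k)
  var-^ k zero    = sym (mono-cong (unit-0 k))
  var-^ k (suc p) = trans (cong (var k *P_) (var-^ k p)) (mono-cong (unit-⊕ 1ℤ (+ p) k))

  ⨁ : ∀ m → (Fin m → Exponent r) → Exponent r
  ⨁ zero    v = replicate r 0ℤ
  ⨁ (suc m) v = v zero ⊕ ⨁ m (v ∘ suc)

  Π-mono : ∀ m {f} (v : Fin m → Exponent r) → (∀ k → f k ≡ mono (v k)) → Π m f ≡ mono (⨁ m v)
  Π-mono zero    v h = refl
  Π-mono (suc m) v h = cong₂ _*P_ (h zero) (Π-mono m (v ∘ suc) (h ∘ suc))

  ⨁-zero : ∀ m (v : Fin m → Exponent r) j → (∀ k → lookup (v k) j ≡ 0ℤ) → lookup (⨁ m v) j ≡ 0ℤ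
  ⨁-zero zero    v j h = lookup-0 j
  ⨁-zero (suc m) v j h = trans (lookup-⊕ (v zero) (⨁ m (v ∘ suc)) j) (cong₂ ℤ._+_ (h zero) (⨁-zero m (v ∘ suc) j (h ∘ suc)))

  ⨁-single : ∀ m (v : Fin m → Exponent r) j i → (∀ k → k ≢ i → lookup (v k) j ≡ 0ℤ) →
    lookup (⨁ m v) j ≡ lookup (v i) j
  ⨁-single (suc m) v j zero h = trans (lookup-⊕ (v zero) (⨁ m (v ∘ suc)) j)
    (trans (cong (λ c → lookup (v zero) j ℤ.+ c) (⨁-zero m (v ∘ suc) j (λ k → h (suc k) (λ ())))) (ℤ.+-identityʳ _))
  ⨁-single (suc m) v j (suc i) h = trans (lookup-⊕ (v zero) (⨁ m (v ∘ suc)) j)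
    (trans (cong₂ ℤ._+_ (h zero (λ ())) (⨁-single m (v ∘ suc) j i (λ k ne → h (suc k) (ne ∘ Fin.suc-injective))))
      (ℤ.+-identityˡ _))

  Π-var : (pos : Fin r → ℕ) → Π r (λ k → var k ^ pos k) ≡ mono (tabulate (λ k → + pos k))
  Π-var pos = trans (Π-mono r (λ k → unit (+ pos k) k) (λ k → var-^ k (pos k))) (mono-cong exponent)
    where
    exponent : ∀ j → lookup (⨁ r (λ k → unit (+ pos k) k)) j ≡ lookup (tabulate (λ k → + pos k)) j
    exponent j = begin
      lookup (⨁ r (λ k → unit (+ pos k) k)) j        ≡⟨ ⨁-single r (λ k → unit (+ pos k) k) j j off ⟩
      lookup (unit (+ pos j) j) j                    ≡⟨ lookup-unit (+ pos j) j j ⟩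
      (if does (j Fin.≟ j) then + pos j else 0ℤ)     ≡⟨ cong (λ b → if b then + pos j else 0ℤ) (dec-true (j Fin.≟ j) refl) ⟩
      + pos j                                        ≡⟨ Vec.lookup∘tabulate (λ k → + pos k) j ⟨
      lookup (tabulate (λ k → + pos k)) j            ∎
      where
      open ≡.≡-Reasoning
      off : ∀ k → k ≢ j → lookup (unit (+ pos k) k) j ≡ 0ℤ
      off k k≢j = trans (lookup-unit (+ pos k) k j)
        (cong (λ b → if b then + pos k else 0ℤ) (dec-false (j Fin.≟ k) (k≢j ∘ sym)))

-- From the two-row relation to `∂°_i`, and the factor z^ρ

module _ {c ℓ} (R : CommutativeRing c ℓ) where
  open CommutativeRing R renaming (_≈_ to _≋_; _+_ to _⊞_; trans to ≋-trans; sym to ≋-sym)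
  open Solver commutativeSemiring using (solve; _:=_; _:+_; _:*_; con)
  open import Relation.Binary.Reasoning.Setoid setoid
  open AbelianGroup +-abelianGroup using (xyx⁻¹≈y)

  ⊞-⁻ : ∀ x y → x ⊞ (y - x) ≋ y
  ⊞-⁻ x y = ≋-trans (≋-sym (+-assoc x y (- x))) (xyx⁻¹≈y x y)

  -- To be read with x , y = z_i , z_{i+1}, a = y⁻¹, m = z^{-ρ}, m′ = s_i m, while g′ , g , s
  -- are the partition functions of w and s_i w and the image of the first under s_i.
  demazure-step : ∀ x y a m m′ g g′ s → y * a ≋ 1# → m′ ≋ m * (x * a) →
    y * g′ ⊞ (y - x) * g ≋ x * s → ((x * a) - 1#) * (m * g) ≋ m * g′ - m′ * s
  demazure-step x y a m m′ g g′ s ya m′≋ swap = begin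
    (x * a - 1#) * (m * g)
      ≈⟨ cancel ⟩
    ((x * a - 1#) * (m * g) ⊞ m′ * s) - m′ * s
      ≈⟨ +-congʳ total ⟩
    m * g′ - m′ * s ∎
    where
    d = y - x
    P = (x * a - 1#) * (m * g)
    cancel : P ≋ (P ⊞ m′ * s) - m′ * s
    cancel = ≋-sym (≋-trans (+-assoc P (m′ * s) (- (m′ * s)))
      (≋-trans (+-congˡ (-‿inverseʳ (m′ * s))) (+-identityʳ P)))
    P+mg : P ⊞ m * g ≋ x * a * (m * g)
    P+mg = begin
      P ⊞ m * g                             ≈⟨ +-congˡ (*-identityˡ (m * g)) ⟨
      P ⊞ 1# * (m * g)                      ≈⟨ distribʳ (m * g) (x * a - 1#) 1# ⟨
      (x * a - 1# ⊞ 1#) * (m * g)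
        ≈⟨ *-congʳ (≋-trans (+-assoc (x * a) (- 1#) 1#)
             (≋-trans (+-congˡ (-‿inverseˡ 1#)) (+-identityʳ (x * a)))) ⟩
      x * a * (m * g) ∎
    m′s : m′ * s ≋ m * a * (y * g′ ⊞ d * g)
    m′s = begin
      m′ * s                      ≈⟨ *-congʳ m′≋ ⟩
      m * (x * a) * s             ≈⟨ solve 4 (λ m x a s → m :* (x :* a) :* s := m :* a :* (x :* s)) refl′ m x a s ⟩
      m * a * (x * s)             ≈⟨ *-congˡ swap ⟨
      m * a * (y * g′ ⊞ d * g)    ∎
      where refl′ = CommutativeRing.refl R
    -- Adding `m * g` to both sides removes the `- 1#` inside `P`; what remains is subtraction-free
    -- once `y - x` is treated as an atom.
    total : P ⊞ m′ * s ≋ m * g′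
    total = AbelianGroup.∙-cancelʳ +-abelianGroup (m * g) (P ⊞ m′ * s) (m * g′) (begin
      P ⊞ m′ * s ⊞ m * g
        ≈⟨ solve 3 (λ p q t → p :+ q :+ t := (p :+ t) :+ q) (CommutativeRing.refl R) P (m′ * s) (m * g) ⟩
      (P ⊞ m * g) ⊞ m′ * s
        ≈⟨ +-cong P+mg m′s ⟩
      x * a * (m * g) ⊞ m * a * (y * g′ ⊞ d * g)
        ≈⟨ solve 7 (λ x a m g y g′ d → x :* a :* (m :* g) :+ m :* a :* (y :* g′ :+ d :* g) :=
             (x :+ d) :* (a :* m :* g) :+ y :* a :* (m :* g′)) (CommutativeRing.refl R) x a m g y g′ d ⟩
      (x ⊞ d) * (a * m * g) ⊞ y * a * (m * g′)
        ≈⟨ +-cong (*-congʳ (⊞-⁻ x y)) (≋-trans (*-congʳ ya) (*-identityˡ (m * g′))) ⟩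
      y * (a * m * g) ⊞ m * g′
        ≈⟨ +-congʳ (≋-trans (solve 4 (λ y a m g → y :* (a :* m :* g) := y :* a :* (m :* g)) (CommutativeRing.refl R) y a m g)
             (≋-trans (*-congʳ ya) (*-identityˡ (m * g)))) ⟩
      m * g ⊞ m * g′
        ≈⟨ +-comm (m * g) (m * g′) ⟩
      m * g′ ⊞ m * g ∎)

negρ : ∀ {n} → Exponent (suc n)
negρ {n} = tabulate (λ k → ℤ.- + (n ∸ toℕ k))

lookup-negρ : ∀ {n} (j : Fin (suc n)) → lookup (negρ {n}) j ≡ ℤ.- + (n ∸ toℕ j)
lookup-negρ {n} j = Vec.lookup∘tabulate (λ k → ℤ.- + (n ∸ toℕ k)) j

zρ-negρ : ∀ {n} → zρ {n} *P mono negρ ≡ 1P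
zρ-negρ {n} = mono-cong (λ j → begin
  lookup (tabulate (λ k → + (n ∸ toℕ k)) ⊕ negρ) j
    ≡⟨ lookup-⊕ (tabulate (λ k → + (n ∸ toℕ k))) negρ j ⟩
  lookup (tabulate (λ k → + (n ∸ toℕ k))) j ℤ.+ lookup negρ j
    ≡⟨ cong₂ ℤ._+_ (Vec.lookup∘tabulate (λ k → + (n ∸ toℕ k)) j) (lookup-negρ j) ⟩
  + (n ∸ toℕ j) ℤ.- + (n ∸ toℕ j)
    ≡⟨ ℤ.+-inverseʳ (+ (n ∸ toℕ j)) ⟩
  0ℤ
    ≡⟨ lookup-0 j ⟨
  lookup (replicate _ 0ℤ) j ∎)
  where open ≡.≡-Reasoning

-- `ρ` drops by exactly one between neighbouring positions, so the swap changes the two exponents by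
-- +1 and -1.
actS-negρ : ∀ {n} (i : Fin n) →
  actS i (mono negρ) ≡ mono negρ *P (var (inject₁ i) *P invVar (suc i))
actS-negρ {n} i = mono-cong (λ j → begin
  lookup (permute i negρ) j                     ≡⟨ lookup-permute i negρ j ⟩
  lookup negρ (swapFun i j)                     ≡⟨ lookup-negρ (swapFun i j) ⟩
  ℤ.- + (n ∸ toℕ (swapFun i j))                 ≡⟨ exponent j (swapView i j) ⟩
  ℤ.- + (n ∸ toℕ j) ℤ.+ (δ⁺ j ℤ.+ δ⁻ j)
    ≡⟨ cong₂ ℤ._+_ (lookup-negρ j) (trans (lookup-⊕ (unit 1ℤ (inject₁ i)) (unit (ℤ.- 1ℤ) (suc i)) j)
         (cong₂ ℤ._+_ (lookup-unit 1ℤ (inject₁ i) j) (lookup-unit (ℤ.- 1ℤ) (suc i) j))) ⟨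
  lookup negρ j ℤ.+ lookup (unit 1ℤ (inject₁ i) ⊕ unit (ℤ.- 1ℤ) (suc i)) j
    ≡⟨ lookup-⊕ negρ (unit 1ℤ (inject₁ i) ⊕ unit (ℤ.- 1ℤ) (suc i)) j ⟨
  lookup (negρ ⊕ (unit 1ℤ (inject₁ i) ⊕ unit (ℤ.- 1ℤ) (suc i))) j ∎)
  where
  open ≡.≡-Reasoning
  δ⁺ δ⁻ : Fin (suc n) → ℤ
  δ⁺ j = if does (j Fin.≟ inject₁ i) then 1ℤ else 0ℤ
  δ⁻ j = if does (j Fin.≟ suc i) then ℤ.- 1ℤ else 0ℤ
  n∸i : + (n ∸ toℕ i) ≡ 1ℤ ℤ.+ + (n ∸ suc (toℕ i))
  n∸i = cong +_ (ℕ.+-∸-assoc 1 (Fin.toℕ<n i))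
  lower-exponent : ∀ a b → a ≡ 1ℤ ℤ.+ b → ℤ.- b ≡ ℤ.- a ℤ.+ (1ℤ ℤ.+ 0ℤ)
  lower-exponent _ b refl = eq b
    where
    eq : ∀ b → ℤ.- b ≡ ℤ.- (1ℤ ℤ.+ b) ℤ.+ (1ℤ ℤ.+ 0ℤ)
    eq = solve-∀
  upper-exponent : ∀ a b → a ≡ 1ℤ ℤ.+ b → ℤ.- a ≡ ℤ.- b ℤ.+ (0ℤ ℤ.+ ℤ.- 1ℤ)
  upper-exponent _ b refl = eq b
    where
    eq : ∀ b → ℤ.- (1ℤ ℤ.+ b) ≡ ℤ.- b ℤ.+ (0ℤ ℤ.+ ℤ.- 1ℤ)
    eq = solve-∀
  exponent : ∀ j → SwapView i j → ℤ.- + (n ∸ toℕ (swapFun i j)) ≡ ℤ.- + (n ∸ toℕ j) ℤ.+ (δ⁺ j ℤ.+ δ⁻ j)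
  exponent _ lower
    rewrite swapFun-inject₁ i | dec-true (inject₁ i Fin.≟ inject₁ i) refl
          | dec-false (inject₁ i Fin.≟ suc i) (inject₁≢suc i) | Fin.toℕ-inject₁ i =
    lower-exponent _ (+ (n ∸ suc (toℕ i))) n∸i
  exponent _ upper
    rewrite swapFun-suc i | dec-true (suc i Fin.≟ suc i) refl
          | dec-false (suc i Fin.≟ inject₁ i) (inject₁≢suc i ∘ sym) | Fin.toℕ-inject₁ i =
    upper-exponent _ (+ (n ∸ suc (toℕ i))) n∸i
  exponent j (other p q)
    rewrite swapFun-other i p q | dec-false (j Fin.≟ inject₁ i) p | dec-false (j Fin.≟ suc i) q =
    sym (ℤ.+-identityʳ _)

-- The recursion along a reduced word

module _ (n : ℕ) (lam : Fin (suc n) → ℕ) (N : ℕ) where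
  open Lattice (lPolyRing (suc n)) (suc n)
  open Sums (lPolyRing (suc n)) (suc n)

  column-of : Fin (suc n) → ℕ
  column-of k = lam k ℕ.+ (n ∸ toℕ k)

  topRow : Vec (Spin (suc n)) (suc N)
  topRow = tabulate (place (suc n) id column-of ∘ toℕ)

  G : (Fin (suc n) → Fin (suc n)) → LPoly (suc n)
  G σ = grid (suc n) var σ topRow

  topSpin-place : ∀ w (j : Fin (suc N)) →
    System.topSpin n lam N w j ≡ place (suc n) id column-of (toℕ j)
  topSpin-place w j = go (suc n) id
    where
    go : ∀ m (h : Fin m → Fin (suc n)) →
      foldr (λ k acc → if does (toℕ j ℕ.≟ column-of k) then just k else acc) nothing (List.tabulate h) ≡
      place m h (column-of ∘ h) (toℕ j)
    go zero    h = refl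
    go (suc m) h = cong (λ s → if does (toℕ j ℕ.≟ column-of (h zero)) then just (h zero) else s) (go m (h ∘ suc))

  Z≈G : ∀ w → Z n lam N w ≈ G (w ⟨$⟩ˡ_)
  Z≈G w μ = trans
    (∑-states N var (w ⟨$⟩ˡ_) (System.topSpin n lam N w) vwPoly
      (λ { k w0 _ → refl ; k w1 _ → refl ; k wz _ → refl }) μ)
    (cong (λ T → coeff (grid (suc n) var (w ⟨$⟩ˡ_) T) μ) (Vec.tabulate-cong (topSpin-place w)))

  G-cong : ∀ {σ τ} → (∀ k → σ k ≡ τ k) → G σ ≈ G τ
  G-cong {σ} {τ} h = grid-cong (suc n) {var} {var} {σ} {τ} topRow (λ _ _ → refl) h

  actS-G : ∀ i σ → actS i (G σ) ≈ grid (suc n) (var ∘ swapFun i) σ topRow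
  actS-G i σ μ = trans
    (Hom.hom-grid (actS i) (λ {p} {q} → actS-cong i {p} {q}) (actS-+ i) (actS-* i)
      (λ _ → refl) (λ κ → cong (λ p → coeff p κ) (actS-1 i)) (suc n) var σ topRow μ)
    (grid-cong (suc n) {actS i ∘ var} {var ∘ swapFun i} {σ} {σ} topRow
      (λ k κ → cong (λ p → coeff p κ) (actS-var i k)) (λ _ → refl) μ)

  demazure-G : ∀ i σ τ → σ (inject₁ i) Fin.< σ (suc i) → (∀ k → σ (swapFun i k) ≡ τ k) →
    IsDemazure₁ i (mono negρ *P G σ) (mono negρ *P G τ)
  demazure-G i σ τ ascent στ μ = trans
    (demazure-step (lPolyRing (suc n)) x y (invVar (suc i)) (mono negρ) (actS i (mono negρ))
      (G τ) (G σ) (actS i (G σ))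
      (λ κ → cong (λ p → coeff p κ) (var-invVar (suc i)))
      (λ κ → cong (λ p → coeff p κ) (actS-negρ i))
      swap μ)
    -- Multiplicativity of `actS` gathers `m′ * s` into s_i of the whole product.
    (+P-cong {p = mono negρ *P G σ} {mono negρ *P G σ} (λ _ → refl)
      (λ κ → trans (coeff-neg (actS i (mono negρ) *P actS i (G σ)) κ)
        (trans (cong ℤ.-_ (sym (actS-* i (mono negρ) (G σ) κ)))
          (sym (coeff-neg (actS i (mono negρ *P G σ)) κ)))) μ)
    where
    x = var (inject₁ i)
    y = var (suc i)
    d = y -P x
    swap : (y *P G σ) +P (d *P G τ) ≈ x *P actS i (G σ)
    swap κ = trans
      (+P-cong {p = y *P G σ} {y *P G σ} {d *P G τ} {d *P G (σ ∘ swapFun i)} (λ _ → refl)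
        (*P-congˡ d {G τ} {G (σ ∘ swapFun i)} (G-cong (λ k → sym (στ k)))) κ)
      (trans (grid-swap i var σ topRow d ascent (⊞-⁻ (lPolyRing (suc n)) x y) κ)
        (*P-congˡ x {grid (suc n) (var ∘ swapFun i) σ topRow} {actS i (G σ)}
          (λ ν → sym (actS-G i σ ν)) κ))

  G-id : IsPartition lam → N ≥ lam zero ℕ.+ n → G id ≈ mono (tabulate (λ k → + column-of k))
  G-id partition N≥ μ = trans
    (grid-increasing (suc n) var id column-of bound anti id μ)
    (cong (λ p → coeff p μ) (Π-var column-of))
    where
    bound : ∀ k → column-of k ℕ.< suc N
    bound k = s≤s (ℕ.≤-trans (ℕ.+-mono-≤ (partition zero k z≤n) (ℕ.m∸n≤m n (toℕ k))) N≥)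
    anti : ∀ {i j} → i Fin.< j → column-of j ℕ.< column-of i
    -- `λ` decreases weakly and `ρ` strictly, so no two colors share a column.
    anti {i} {j} i<j = ℕ.+-mono-≤-< (partition i j (ℕ.<⇒≤ i<j)) (ℕ.∸-monoʳ-< i<j (ℕ.≤-pred (Fin.toℕ<n j)))

  -- `σ` is a two-sided inverse of the word as a bare function, and minimality speaks of words only,
  -- so the induction passes to suffixes without building permutations.
  demazure : IsPartition lam → N ≥ lam zero ℕ.+ n → ∀ ws σ →
    (∀ k → σ (wordFun ws k) ≡ k) → (∀ k → wordFun ws (σ k) ≡ k) →
    (∀ js → (∀ k → wordFun ws k ≡ wordFun js k) → length ws ℕ.≤ length js) →
    IsDemazure ws (zPow lam) (mono negρ *P G σ)
  demazure partition N≥ [] σ σˡ σʳ reduced μ = trans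
    (*P-congˡ (mono negρ) {G σ} {mono (tabulate (λ k → + column-of k))}
      (λ κ → trans (G-cong {σ} {id} σˡ κ) (G-id partition N≥ κ)) μ)
    (cong (λ p → coeff p μ)
      (mono-cong {μ = negρ ⊕ tabulate (λ k → + column-of k)} {ν = tabulate (λ k → + lam k)} exponent))
    where
    open ≡.≡-Reasoning
    exponent : ∀ j → lookup (negρ ⊕ tabulate (λ k → + column-of k)) j ≡ lookup (tabulate (λ k → + lam k)) j
    exponent j = begin
      lookup (negρ ⊕ tabulate (λ k → + column-of k)) j
        ≡⟨ lookup-⊕ negρ (tabulate (λ k → + column-of k)) j ⟩
      lookup negρ j ℤ.+ lookup (tabulate (λ k → + column-of k)) j
        ≡⟨ cong₂ ℤ._+_ (lookup-negρ j) (Vec.lookup∘tabulate (λ k → + column-of k) j) ⟩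
      ℤ.- + (n ∸ toℕ j) ℤ.+ (+ lam j ℤ.+ + (n ∸ toℕ j))
        ≡⟨ eq (+ (n ∸ toℕ j)) (+ lam j) ⟩
      + lam j
        ≡⟨ Vec.lookup∘tabulate (λ k → + lam k) j ⟨
      lookup (tabulate (λ k → + lam k)) j ∎
      where
      eq : ∀ a b → ℤ.- a ℤ.+ (b ℤ.+ a) ≡ b
      eq = solve-∀
  demazure partition N≥ (i ∷ ws) σ σˡ σʳ reduced =
    mono negρ *P G τ ,
    demazure partition N≥ ws τ σˡ τʳ
      -- A shorter word for the suffix, preceded by `i`, would shorten the whole word.
      (λ js e → ℕ.≤-pred (reduced (i ∷ js) (λ k → cong (swapFun i) (e k)))) ,
    demazure-G i τ σ
      -- `τ` inverts the suffix, so these are the colors leaving the two rows before `i` is applied;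
      -- the smaller index is the larger color.
      (reduced⇒ascent i ws reduced (τ (inject₁ i)) (τ (suc i)) (τʳ (inject₁ i)) (τʳ (suc i)))
      (λ k → cong σ (swapFun-involutive i k))
    where
    τ : Fin (suc n) → Fin (suc n)
    τ = σ ∘ swapFun i
    τʳ : ∀ k → wordFun ws (τ k) ≡ k
    τʳ k = trans (sym (swapFun-involutive i _))
      (trans (cong (swapFun i) (σʳ (swapFun i k))) (swapFun-involutive i k))

open import Data.Nat using (_+_)

theorem4p4 : (n : ℕ) (lam : Fin (suc n) → ℕ) → IsPartition lam →
    (N : ℕ) → N ≥ lam zero + n →
    (w : Permutation′ (suc n)) (word : List (Fin n)) → IsReducedWordFor w word →
    Σ (LPoly (suc n)) (λ g → IsDemazure word (zPow lam) g × (Z n lam N w ≈ zρ *P g))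
theorem4p4 n lam partition N N≥ w word (w≡ , shortest) =
  -- Choosing the partition function divided by z^ρ as the value of `∂°_w` makes the product formula
  -- a cancellation and leaves the recursion to `demazure`.
  mono negρ *P G n lam N σ ,
  demazure n lam N partition N≥ word σ
    (λ k → trans (cong σ (sym (w≡ k))) (inverseˡ w))
    (λ k → trans (sym (w≡ (σ k))) (inverseʳ w))
    (λ js e → shortest js (λ k → trans (w≡ k) (e k))) ,
  (λ μ → begin
    coeff (Z n lam N w) μ                              ≡⟨ Z≈G n lam N w μ ⟩
    coeff (G n lam N σ) μ                              ≡⟨ *P-identityˡ (G n lam N σ) μ ⟨
    coeff (1P *P G n lam N σ) μ                        ≡⟨ cong (λ p → coeff (p *P G n lam N σ) μ) zρ-negρ ⟨
    coeff ((zρ *P mono negρ) *P G n lam N σ) μ         ≡⟨ *P-assoc zρ (mono negρ) (G n lam N σ) μ ⟩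
    coeff (zρ *P (mono negρ *P G n lam N σ)) μ         ∎)
  where
  open ≡.≡-Reasoning
  σ = w ⟨$⟩ˡ_
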